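{- For $n\ge 1$ let $\beta_n$ be the number of pairs $(T,v)$ with $T$ a Motzkin tree on $n$ vertices and $v$ a balanced vertex of $T$, and let $\rho_n$ be the sum of the ranks of $v$ over all such pairs $(T,v)$. Then the asymptotic expected rank of a balanced vertex, $\lim_{n\to\infty}\frac{\rho_n}{\beta_n}$, satisfies $$0.6464847301966947\ \le\ \lim_{n\to\infty}\frac{\rho_n}{\beta_n}\ \le\ 0.64648473019669473 .$$
   Context: A Motzkin tree (0-1-2 tree, unary-binary tree) is a rooted plane tree, with at least one vertex, in which every vertex has 0, 1 or 2 children (a single child carries no left/right distinction; two children are ordered). A leaf is a vertex with no children. The rank of a vertex $v$ is the length (number of edges) of the shortest path from $v$ to a leaf travelling strictly from parent to child; leaves have rank 0. A vertex $v$ is balanced if all parent-to-child paths from $v$ to a leaf have the same length. The limit $\lim_{n\to\infty}\rho_n/\beta_n$ is known to exist. -}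

module Defs where

import Data.Integer.Base as ℤ
open import Data.List.Base
  using (List; []; _∷_; _++_; map; concatMap; cartesianProductWith; filter; length; upTo)
open import Data.List.Membership.Propositional using (_∈_; find; lose)
open import Data.List.Membership.Propositional.Properties
  using ( ∈-map⁺; ∈-map⁻; ∈-++⁺ˡ; ∈-++⁺ʳ; ∈-++⁻; ∈-concatMap⁺; ∈-concatMap⁻; ∈-length
        ; ∈-cartesianProductWith⁺; ∈-cartesianProductWith⁻; ∈-filter⁺; ∈-filter⁻
        ; ∈-upTo⁺; ∈-upTo⁻)
open import Data.List.Relation.Unary.All as All using ([])
open import Data.List.Relation.Unary.AllPairs using ([]; _∷_)
open import Data.List.Relation.Unary.Any as Any using (here; there; satisfied)
open import Data.List.Relation.Unary.Unique.Propositional using (Unique)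
import Data.List.Relation.Unary.Unique.Propositional.Properties as Uniqueₚ
open import Data.Nat.ListAction using (sum)
open import Data.Nat.Base using (ℕ; zero; suc; _+_; _∸_; _≤_; z≤n; s≤s; NonZero; >-nonZero)
open import Data.Nat.Properties
  using (_≟_; ≤-refl; ≤-trans; ≤-total; m≤m+n; m≤n+m; m+[n∸m]≡n; m+n∸m≡n; suc-injective)
open import Data.Product.Base using (Σ-syntax; ∃-syntax; _×_; _,_; proj₁; proj₂)
open import Data.Rational.Unnormalised.Base as ℚᵘ using (ℚᵘ; 0ℚᵘ)
import Data.Rational.Unnormalised.Properties as ℚᵘₚ
open import Data.Sum.Base using (_⊎_; inj₁; inj₂)
open import Function.Bundles using (_⇔_; mk⇔; Equivalence)
open import Relation.Binary.PropositionalEquality.Core using (_≡_; refl; sym; trans; cong; subst)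
open import Relation.Nullary.Decidable using (Dec; yes; no; map′)
open import Relation.Nullary.Negation using (¬_)
open import Relation.Unary using (Decidable)

data Tree : Set where
  leaf   : Tree
  unary  : Tree → Tree
  binary : Tree → Tree → Tree

size : Tree → ℕ
size leaf         = 1
size (unary t)    = suc (size t)
size (binary l r) = suc (size l + size r)

data Vertex : Tree → Set where
  root  : ∀ {t} → Vertex t
  below : ∀ {t} → Vertex t → Vertex (unary t)
  left  : ∀ {l r} → Vertex l → Vertex (binary l r)
  right : ∀ {l r} → Vertex r → Vertex (binary l r)

-- The tree of all descendants of a vertex.
subtree : ∀ {t} → Vertex t → Tree
subtree {t} root  = t
subtree (below v) = subtree v
subtree (left v)  = subtree v
subtree (right v) = subtree v

-- Parent-to-child paths from the root of a tree to one of its leaves.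
data Path : Tree → Set where
  stop  : Path leaf
  down  : ∀ {t} → Path t → Path (unary t)
  downˡ : ∀ {l r} → Path l → Path (binary l r)
  downʳ : ∀ {l r} → Path r → Path (binary l r)

∥_∥ : ∀ {t} → Path t → ℕ
∥ stop ∥    = 0
∥ down p ∥  = suc ∥ p ∥
∥ downˡ p ∥ = suc ∥ p ∥
∥ downʳ p ∥ = suc ∥ p ∥

shortestPath : ∀ t → Σ[ p ∈ Path t ] ((q : Path t) → ∥ p ∥ ≤ ∥ q ∥)
shortestPath leaf = stop , λ _ → z≤n
shortestPath (unary t) with shortestPath t
... | p , p-min = down p , λ { (down q) → s≤s (p-min q) }
shortestPath (binary l r) with shortestPath l | shortestPath r
... | p , p-min | q , q-min with ≤-total ∥ p ∥ ∥ q ∥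
...   | inj₁ p≤q = downˡ p , λ { (downˡ p′) → s≤s (p-min p′)
                               ; (downʳ q′) → s≤s (≤-trans p≤q (q-min q′)) }
...   | inj₂ q≤p = downʳ q , λ { (downˡ p′) → s≤s (≤-trans q≤p (p-min p′))
                               ; (downʳ q′) → s≤s (q-min q′) }

rank : ∀ {t} → Vertex t → ℕ
rank v = ∥ proj₁ (shortestPath (subtree v)) ∥

Uniform : Tree → Set
Uniform t = (p q : Path t) → ∥ p ∥ ≡ ∥ q ∥

Balanced : ∀ {t} → Vertex t → Set
Balanced v = Uniform (subtree v)

uniform? : Decidable Uniform
uniform? leaf = yes λ { stop stop → refl }
uniform? (unary t) =
  map′ (λ u → λ { (down p) (down q) → cong suc (u p q) })
       (λ u p q → suc-injective (u (down p) (down q)))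
       (uniform? t)
uniform? (binary l r) with uniform? l | uniform? r
... | no ¬u | _     = no λ u → ¬u λ p q → suc-injective (u (downˡ p) (downˡ q))
... | yes _ | no ¬u = no λ u → ¬u λ p q → suc-injective (u (downʳ p) (downʳ q))
... | yes uˡ | yes uʳ with shortestPath l | shortestPath r
...   | p , _ | q , _ with ∥ p ∥ ≟ ∥ q ∥
...     | no p≢q = no λ u → p≢q (suc-injective (u (downˡ p) (downʳ q)))
...     | yes p≡q = yes λ
  { (downˡ p₁) (downˡ p₂) → cong suc (uˡ p₁ p₂)
  ; (downʳ q₁) (downʳ q₂) → cong suc (uʳ q₁ q₂)
  ; (downˡ p₁) (downʳ q₁) → cong suc (across p₁ q₁)
  ; (downʳ q₁) (downˡ p₁) → cong suc (sym (across p₁ q₁)) }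
  where
  across : ∀ p₁ q₁ → ∥ p₁ ∥ ≡ ∥ q₁ ∥
  across p₁ q₁ = trans (uˡ p₁ p) (trans p≡q (uʳ q q₁))

balanced? : ∀ {t} (v : Vertex t) → Dec (Balanced v)
balanced? v = uniform? (subtree v)

-- The first argument of treesWithin is fuel, which never runs out as long
-- as it is at least the requested size.
treesWithin : ℕ → ℕ → List Tree
leafIfEmpty : ℕ → List Tree

leafIfEmpty zero    = leaf ∷ []
leafIfEmpty (suc _) = []

treesWithin zero    _       = []
treesWithin (suc f) zero    = []
treesWithin (suc f) (suc n) =
  leafIfEmpty n
  ++ map unary (treesWithin f n)
  ++ concatMap (λ i → cartesianProductWith binary (treesWithin f i) (treesWithin f (n ∸ i)))
               (upTo (suc n))

trees : ℕ → List Tree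
trees n = treesWithin n n

vertices : ∀ t → List (Vertex t)
vertices leaf         = root ∷ []
vertices (unary t)    = root ∷ map below (vertices t)
vertices (binary l r) = root ∷ map left (vertices l) ++ map right (vertices r)

PointedTree : Set
PointedTree = Σ[ t ∈ Tree ] Vertex t

pointedTrees : ℕ → List PointedTree
pointedTrees n = concatMap (λ t → map (t ,_) (vertices t)) (trees n)

balancedPairs : ℕ → List PointedTree
balancedPairs n = filter (λ x → balanced? (proj₂ x)) (pointedTrees n)

β : ℕ → ℕ
β n = length (balancedPairs n)

ρ : ℕ → ℕ
ρ n = sum (map (λ x → rank (proj₂ x)) (balancedPairs n))

private
  unique-concatMap : ∀ {A B : Set} (f : A → List B) {xs} →
    (∀ x → Unique (f x)) → (∀ {x y z} → x ∈ xs → y ∈ xs → z ∈ f x → z ∈ f y → x ≡ y) →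
    Unique xs → Unique (concatMap f xs)
  unique-concatMap f {[]} _ _ _ = []
  unique-concatMap f {x ∷ xs} uf inj (x∉ ∷ u) =
    Uniqueₚ.++⁺ (uf x) (unique-concatMap f uf (λ a b → inj (there a) (there b)) u)
      λ { (z∈fx , z∈rest) → clash z∈fx (∈-concatMap⁻ f z∈rest) }
    where
    clash : ∀ {z} → z ∈ f x → ¬ Any.Any (λ y → z ∈ f y) xs
    clash z∈fx any with y , y∈ , z∈fy ← find any =
      All.lookup x∉ y∈ (inj (here refl) (there y∈) z∈fx z∈fy)

  split : ℕ → ℕ → ℕ → List Tree
  split f n i = cartesianProductWith binary (treesWithin f i) (treesWithin f (n ∸ i))

  sound : ∀ f n {t} → t ∈ treesWithin f n → size t ≡ n
  split-sound : ∀ f n i {t} → t ∈ split f n i →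
    Σ[ l ∈ Tree ] Σ[ r ∈ Tree ] t ≡ binary l r × size l ≡ i × size r ≡ n ∸ i
  leaf-sound : ∀ n {t} → t ∈ leafIfEmpty n → t ≡ leaf × n ≡ 0

  leaf-sound zero (here refl) = refl , refl

  split-sound f n i t∈
    with l , r , l∈ , r∈ , refl ← ∈-cartesianProductWith⁻ binary (treesWithin f i) (treesWithin f (n ∸ i)) t∈
    = l , r , refl , sound f i l∈ , sound f (n ∸ i) r∈

  sound zero    _       ()
  sound (suc f) zero    ()
  sound (suc f) (suc n) t∈ with ∈-++⁻ (leafIfEmpty n) t∈
  ... | inj₁ t∈₁ with refl , refl ← leaf-sound n t∈₁ = refl
  ... | inj₂ t∈₂ with ∈-++⁻ (map unary (treesWithin f n)) t∈₂
  ...   | inj₁ t∈₃ with s , s∈ , refl ← ∈-map⁻ unary t∈₃ = cong suc (sound f n s∈)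
  ...   | inj₂ t∈₃ with i , i∈ , t∈ᵢ ← find (∈-concatMap⁻ (split f n) {xs = upTo (suc n)} t∈₃)
                   with l , r , refl , refl , eq ← split-sound f n i t∈ᵢ
                      | s≤s i≤n ← ∈-upTo⁻ i∈
    = cong suc (trans (cong (size l +_) eq) (m+[n∸m]≡n i≤n))

  complete : ∀ f t → size t ≤ f → t ∈ treesWithin f (size t)
  complete (suc f) leaf _ = here refl
  complete (suc f) (unary t) (s≤s le) =
    ∈-++⁺ʳ (leafIfEmpty (size t)) (∈-++⁺ˡ (∈-map⁺ unary (complete f t le)))
  complete (suc f) (binary l r) (s≤s le) =
    ∈-++⁺ʳ (leafIfEmpty n) (∈-++⁺ʳ (map unary (treesWithin f n))
      (∈-concatMap⁺ (split f n) (lose (∈-upTo⁺ (s≤s (m≤m+n (size l) (size r))))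
        (∈-cartesianProductWith⁺ binary
          (complete f l (≤-trans (m≤m+n (size l) (size r)) le))
          (subst (λ k → r ∈ treesWithin f k) (sym (m+n∸m≡n (size l) (size r)))
            (complete f r (≤-trans (m≤n+m (size r) (size l)) le)))))))
    where n = size l + size r

  unique-treesWithin : ∀ f n → Unique (treesWithin f n)
  unique-treesWithin zero    _       = []
  unique-treesWithin (suc f) zero    = []
  unique-treesWithin (suc f) (suc n) =
    Uniqueₚ.++⁺ (unique-leaf n)
      (Uniqueₚ.++⁺ (Uniqueₚ.map⁺ (λ { refl → refl }) (unique-treesWithin f n))
        (unique-concatMap (split f n)
          (λ i → Uniqueₚ.cartesianProductWith⁺ binary (λ { refl → refl , refl })
                   (unique-treesWithin f i) (unique-treesWithin f (n ∸ i)))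
          (λ {i} {j} _ _ → same i j)
          (Uniqueₚ.upTo⁺ (suc n)))
        λ { (u∈ , b∈) → unary≢binary u∈ b∈ })
      λ { (l∈ , r∈) → leaf≢rest (proj₁ (leaf-sound n l∈)) (∈-++⁻ (map unary (treesWithin f n)) r∈) }
    where
    unique-leaf : ∀ n → Unique (leafIfEmpty n)
    unique-leaf zero    = [] ∷ []
    unique-leaf (suc _) = []

    same : ∀ i j {t} → t ∈ split f n i → t ∈ split f n j → i ≡ j
    same i j t∈ᵢ t∈ⱼ with _ , _ , refl , refl , _ ← split-sound f n i t∈ᵢ
                        | _ , _ , refl , refl , _ ← split-sound f n j t∈ⱼ = refl

    unary≢binary : ∀ {t} → t ∈ map unary (treesWithin f n) →
                   ¬ t ∈ concatMap (split f n) (upTo (suc n))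
    unary≢binary u∈ b∈ with _ , _ , refl ← ∈-map⁻ unary u∈
                          | i , b∈ᵢ ← satisfied (∈-concatMap⁻ (split f n) {xs = upTo (suc n)} b∈)
                       with _ , _ , () , _ ← split-sound f n i b∈ᵢ

    leaf≢rest : ∀ {t} → t ≡ leaf → ¬ (t ∈ map unary (treesWithin f n) ⊎
                                       t ∈ concatMap (split f n) (upTo (suc n)))
    leaf≢rest refl (inj₁ u∈) with _ , _ , () ← ∈-map⁻ unary u∈
    leaf≢rest refl (inj₂ b∈) with i , b∈ᵢ ← satisfied (∈-concatMap⁻ (split f n) {xs = upTo (suc n)} b∈)
                             with _ , _ , () , _ ← split-sound f n i b∈ᵢ

∈-trees : ∀ {n t} → t ∈ trees n ⇔ size t ≡ n
∈-trees {n} {t} = mk⇔ (sound n n) (λ { refl → complete (size t) t ≤-refl })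

unique-trees : ∀ n → Unique (trees n)
unique-trees n = unique-treesWithin n n

∈-vertices : ∀ {t} (v : Vertex t) → v ∈ vertices t
∈-vertices {leaf}       root      = here refl
∈-vertices {unary _}    root      = here refl
∈-vertices {binary _ _} root      = here refl
∈-vertices {unary _}    (below v) = there (∈-map⁺ below (∈-vertices v))
∈-vertices {binary _ _} (left v)  = there (∈-++⁺ˡ (∈-map⁺ left (∈-vertices v)))
∈-vertices {binary l _} (right v) = there (∈-++⁺ʳ (map left (vertices l)) (∈-map⁺ right (∈-vertices v)))

unique-vertices : ∀ t → Unique (vertices t)
unique-vertices leaf = [] ∷ []
unique-vertices (unary t) =
  All.tabulate (λ v∈ root≡v → root∉ (subst (_∈ _) (sym root≡v) v∈))
  ∷ Uniqueₚ.map⁺ (λ { refl → refl }) (unique-vertices t)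
  where
  root∉ : ¬ root ∈ map below (vertices t)
  root∉ r∈ with _ , _ , () ← ∈-map⁻ below r∈
unique-vertices (binary l r) =
  All.tabulate (λ v∈ root≡v → root∉ (subst (_∈ _) (sym root≡v) v∈))
  ∷ Uniqueₚ.++⁺ (Uniqueₚ.map⁺ (λ { refl → refl }) (unique-vertices l))
                (Uniqueₚ.map⁺ (λ { refl → refl }) (unique-vertices r))
                λ { (l∈ , r∈) → left≢right l∈ r∈ }
  where
  root∉ : ¬ root ∈ map left (vertices l) ++ map right (vertices r)
  root∉ r∈ with ∈-++⁻ (map left (vertices l)) r∈
  ... | inj₁ l∈ with _ , _ , () ← ∈-map⁻ left l∈
  ... | inj₂ l∈ with _ , _ , () ← ∈-map⁻ right l∈
  left≢right : ∀ {v} → v ∈ map left (vertices l) → ¬ v ∈ map right (vertices r)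
  left≢right l∈ r∈ with _ , _ , refl ← ∈-map⁻ left l∈
                      | _ , _ , () ← ∈-map⁻ right r∈

∈-balancedPairs : ∀ {n t} {v : Vertex t} → (t , v) ∈ balancedPairs n ⇔ (size t ≡ n × Balanced v)
∈-balancedPairs {n} {t} {v} = mk⇔ to from
  where
  P? = λ (x : PointedTree) → balanced? (proj₂ x)
  point = λ (s : Tree) → map (s ,_) (vertices s)

  to : (t , v) ∈ balancedPairs n → size t ≡ n × Balanced v
  to x∈ with x∈′ , b ← ∈-filter⁻ P? {xs = pointedTrees n} x∈
           with s , s∈ , x∈ₛ ← find (∈-concatMap⁻ point x∈′)
           with _ , _ , refl ← ∈-map⁻ (s ,_) x∈ₛ = sound n n s∈ , b

  from : size t ≡ n × Balanced v → (t , v) ∈ balancedPairs n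
  from (refl , b) = ∈-filter⁺ P?
    (∈-concatMap⁺ point (lose (complete (size t) t ≤-refl) (∈-map⁺ (t ,_) (∈-vertices v)))) b

unique-balancedPairs : ∀ n → Unique (balancedPairs n)
unique-balancedPairs n = Uniqueₚ.filter⁺ (λ x → balanced? (proj₂ x))
  (unique-concatMap (λ t → map (t ,_) (vertices t))
    (λ t → Uniqueₚ.map⁺ (λ { refl → refl }) (unique-vertices t))
    (λ _ _ → same)
    (unique-trees n))
  where
  same : ∀ {s t} {x : PointedTree} → x ∈ map (s ,_) (vertices s) → x ∈ map (t ,_) (vertices t) → s ≡ t
  same {s} {t} x∈ y∈ with _ , _ , refl ← ∈-map⁻ (s ,_) x∈
                        | _ , _ , refl ← ∈-map⁻ (t ,_) y∈ = refl

private
  chain : ℕ → Tree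
  chain zero    = leaf
  chain (suc n) = unary (chain n)

  size-chain : ∀ n → size (chain n) ≡ suc n
  size-chain zero    = refl
  size-chain (suc n) = cong suc (size-chain n)

  chain-uniform : ∀ n → Uniform (chain n)
  chain-uniform zero    stop     stop     = refl
  chain-uniform (suc n) (down p) (down q) = cong suc (chain-uniform n p q)

instance
  β-nonZero : ∀ {n} .{{_ : NonZero n}} → NonZero (β n)
  β-nonZero {suc n} = >-nonZero (∈-length (Equivalence.from (∈-balancedPairs {v = root})
    (size-chain n , chain-uniform n)))

expectedRank : (n : ℕ) .{{_ : NonZero n}} → ℚᵘ
expectedRank n = ℤ.+ ρ n ℚᵘ./ β n

-- Two Cauchy sequences denote the same real when each is ≤ᴿ the other.
record ℝ : Set where
  field
    approx : ℕ → ℚᵘ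
    cauchy : ∀ ε → 0ℚᵘ ℚᵘ.< ε →
             ∃[ N ] (∀ m n → N ≤ m → N ≤ n → ℚᵘ.∣ approx m ℚᵘ.- approx n ∣ ℚᵘ.≤ ε)

open ℝ public

infix 4 _≤ᴿ_

_≤ᴿ_ : ℝ → ℝ → Set
x ≤ᴿ y = ∀ ε → 0ℚᵘ ℚᵘ.< ε → ∃[ N ] (∀ n → N ≤ n → approx x n ℚᵘ.≤ approx y n ℚᵘ.+ ε)

fromℚ : ℚᵘ → ℝ
fromℚ q = record
  { approx = λ _ → q
  ; cauchy = λ ε 0<ε → 0 , λ _ _ _ _ →
      ℚᵘₚ.≤-trans (ℚᵘₚ.≤-reflexive (ℚᵘₚ.∣-∣-cong (ℚᵘₚ.+-inverseʳ q))) (ℚᵘₚ.<⇒≤ 0<ε)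
  }

-- The condition |a n - L| ≤ ε is written out as a n - ε ≤ L ≤ a n + ε.
_ConvergesTo_ : (ℕ → ℚᵘ) → ℝ → Set
a ConvergesTo L = ∀ ε → 0ℚᵘ ℚᵘ.< ε →
  ∃[ N ] (∀ n → N ≤ n → fromℚ (a n ℚᵘ.- ε) ≤ᴿ L × L ≤ᴿ fromℚ (a n ℚᵘ.+ ε))

module Submission where

open import Algebra.Bundles using (CommutativeSemiring)
import Algebra.Solver.Ring.NaturalCoefficients.Default as SemiringSolver
import Algebra.Structures.Biased as Biased
open import Data.Bool.Base using (T; if_then_else_)
open import Data.Empty using (⊥-elim)
import Data.Integer.Base as ℤ
import Data.Integer.Properties as ℤₚ
open import Data.List.Base as List
  using (List; []; _∷_; _++_; concatMap; cartesianProductWith; filter; length; upTo; applyUpTo)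
open import Data.List.Membership.Propositional.Properties using (∈-upTo⁻)
open import Data.List.Properties using (map-++; map-∘; map-cong; map-cong-local; map-applyUpTo)
import Data.List.Relation.Unary.All as All
open import Data.Nat.Base as ℕ hiding (_/_)
open import Data.Nat.DivMod using (m≡m%n+[m/n]*n; m%n<n; m/n*n≤m; m/n<m; m<n*o⇒m/o<n)
open import Data.Nat.ListAction using (sum)
open import Data.Nat.ListAction.Properties using (sum-++)
open import Data.Nat.Properties
open import Data.Nat.Tactic.RingSolver using (solve-∀)
open import Data.Product.Base using (Σ-syntax; ∃-syntax; _×_; _,_; proj₁; proj₂)
open import Data.Rational.Unnormalised.Base as ℚᵘ using (ℚᵘ; mkℚᵘ; 0ℚᵘ; _/_; *≤*; *<*; ↧ₙ_)
import Data.Rational.Unnormalised.Properties as ℚᵘₚ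
open import Data.Sum.Base using (_⊎_; inj₁; inj₂)
open import Data.Unit.Base using (tt)
open import Function.Base using (id; const)
open import Function.Bundles using (Equivalence)
open import Level using (0ℓ)
open import Relation.Binary.Bundles using (Setoid)
open import Relation.Binary.PropositionalEquality
  using (_≡_; _≢_; refl; sym; trans; cong; cong₂; subst; subst₂; _≗_; _→-setoid_; module ≡-Reasoning)
open import Relation.Nullary.Decidable using (does; yes; no)
open import Relation.Nullary.Negation using (¬_)
open import Relation.Unary using (Decidable)
-- With β-nonZero in scope, instance search tries to solve every NonZero goal by unfolding β.
import Defs hiding (β-nonZero)
open Defs

-- Let C be the generating function of trees with one marked leaf, that leaf not being counted, and U k that of the
-- trees all of whose leaves have depth k.  Then β and ρ have generating functions Σₖ U k · C and Σₖ k · U k · C.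
-- The coefficients of C are the central trinomial coefficients, whose recurrence makes C (n + 1) / C n tend to 3.
-- As U 0 = z and U (k + 1) = z (U k + (U k)²), the coefficients of U k · C are asymptotic to bₖ · C n with b₀ = 1/3
-- and bₖ₊₁ = (bₖ + bₖ²) / 3, and they are at most (3/4)ᵏ · C n throughout, because C doubles at every step but one.
-- So ρ / β tends to (Σₖ k bₖ) / (Σₖ bₖ).  The sums are enclosed by cutting them at K and rounding the bₖ to multiples
-- of 1/D: large K and D give the Cauchy property, and K = 400, D = 10⁴⁰ the digits.

-- Power series with natural coefficients

-- `U k` is a polynomial and `C` is (1 - 2z - 3z²)^(-1/2), so bₖ is the value of `U k` at the
-- dominant singularity 1/3. Singularity analysis is avoided: convolution with z is a shift, the
-- ratio of consecutive coefficients of `C` controls that shift, and `U k` is built from z by sums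
-- and products, so bounds on `U k ⊛ C` come from composing operators. The obstacle is that the
-- number of ranks grows with n: a limit for each fixed k says nothing about the whole sum unless
-- the terms are dominated uniformly in n. As the limit must come with an explicit modulus of
-- convergence, every estimate is an inequality between naturals with the fractions
-- cross-multiplied.

Series : Set
Series = ℕ → ℕ

infixl 6 _⊕_
infixl 7 _⊛_

tail : Series → Series
tail f n = f (suc n)

𝟘 𝟙 z : Series
𝟘 _ = 0
𝟙 zero    = 1
𝟙 (suc _) = 0
z zero    = 0
z (suc n) = 𝟙 n

-- Recursion on the tail of the left factor, rather than a sum over an index, lets the semiring laws
-- be proved by induction on n with that factor generalised.
_⊕_ _⊛_ : Series → Series → Series
(f ⊕ g) n = f n + g n
(f ⊛ g) zero    = f 0 * g 0
(f ⊛ g) (suc n) = f 0 * g (suc n) + (tail f ⊛ g) n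

⊛-cong : ∀ {f f′ g g′} → f ≗ f′ → g ≗ g′ → f ⊛ g ≗ f′ ⊛ g′
⊛-cong p q zero    = cong₂ _*_ (p 0) (q 0)
⊛-cong p q (suc n) = cong₂ _+_ (cong₂ _*_ (p 0) (q (suc n))) (⊛-cong (λ i → p (suc i)) q n)

⊛-zeroˡ : ∀ f → 𝟘 ⊛ f ≗ 𝟘
⊛-zeroˡ f zero    = refl
⊛-zeroˡ f (suc n) = ⊛-zeroˡ f n

⊛-identityˡ : ∀ f → 𝟙 ⊛ f ≗ f
⊛-identityˡ f zero    = +-identityʳ (f 0)
⊛-identityˡ f (suc n) = trans (cong₂ _+_ (+-identityʳ (f (suc n))) (⊛-zeroˡ f n)) (+-identityʳ (f (suc n)))

⊛-distribʳ : ∀ h f g → (f ⊕ g) ⊛ h ≗ f ⊛ h ⊕ g ⊛ h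
⊛-distribʳ h f g zero    = *-distribʳ-+ (h 0) (f 0) (g 0)
⊛-distribʳ h f g (suc n) rewrite ⊛-distribʳ h (tail f) (tail g) n =
  rearrange (f 0) (g 0) (h (suc n)) ((tail f ⊛ h) n) ((tail g ⊛ h) n)
  where
  rearrange : ∀ a b c d e → (a + b) * c + (d + e) ≡ (a * c + d) + (b * c + e)
  rearrange = solve-∀

⊛-scale : ∀ a f g n → ((λ i → a * f i) ⊛ g) n ≡ a * (f ⊛ g) n
⊛-scale a f g zero    = *-assoc a (f 0) (g 0)
⊛-scale a f g (suc n) rewrite ⊛-scale a (tail f) g n = rearrange a (f 0) (g (suc n)) ((tail f ⊛ g) n)
  where
  rearrange : ∀ a b c d → a * b * c + a * d ≡ a * (b * c + d)
  rearrange = solve-∀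

-- The mirror image of the defining equation, peeling off the right factor; commutativity needs both
-- forms.
⊛-sucʳ : ∀ f g n → (f ⊛ g) (suc n) ≡ f (suc n) * g 0 + (f ⊛ tail g) n
⊛-sucʳ f g zero    = +-comm (f 0 * g 1) (f 1 * g 0)
⊛-sucʳ f g (suc n) rewrite ⊛-sucʳ (tail f) g n =
  rearrange (f 0 * g (suc (suc n))) (f (suc (suc n)) * g 0) ((tail f ⊛ tail g) n)
  where
  rearrange : ∀ a b c → a + (b + c) ≡ b + (a + c)
  rearrange = solve-∀

⊛-comm : ∀ f g → f ⊛ g ≗ g ⊛ f
⊛-comm f g zero    = *-comm (f 0) (g 0)
⊛-comm f g (suc n) = begin
  f 0 * g (suc n) + (tail f ⊛ g) n ≡⟨ cong₂ _+_ (*-comm (f 0) (g (suc n))) (⊛-comm (tail f) g n) ⟩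
  g (suc n) * f 0 + (g ⊛ tail f) n ≡⟨ ⊛-sucʳ g f n ⟨
  (g ⊛ f) (suc n)                  ∎
  where open ≡-Reasoning

⊛-assoc : ∀ f g h → (f ⊛ g) ⊛ h ≗ f ⊛ (g ⊛ h)
⊛-assoc f g h zero    = *-assoc (f 0) (g 0) (h 0)
⊛-assoc f g h (suc n) = begin
  f 0 * g 0 * h (suc n) + (((λ i → f 0 * tail g i) ⊕ tail f ⊛ g) ⊛ h) n
    ≡⟨ cong (f 0 * g 0 * h (suc n) +_) (⊛-distribʳ h (λ i → f 0 * tail g i) (tail f ⊛ g) n) ⟩
  f 0 * g 0 * h (suc n) + (((λ i → f 0 * tail g i) ⊛ h) n + ((tail f ⊛ g) ⊛ h) n)
    ≡⟨ cong (f 0 * g 0 * h (suc n) +_) (cong₂ _+_ (⊛-scale (f 0) (tail g) h n) (⊛-assoc (tail f) g h n)) ⟩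
  f 0 * g 0 * h (suc n) + (f 0 * (tail g ⊛ h) n + (tail f ⊛ (g ⊛ h)) n)
    ≡⟨ rearrange (f 0) (g 0) (h (suc n)) ((tail g ⊛ h) n) ((tail f ⊛ (g ⊛ h)) n) ⟩
  f 0 * (g 0 * h (suc n) + (tail g ⊛ h) n) + (tail f ⊛ (g ⊛ h)) n ∎
  where
  open ≡-Reasoning
  rearrange : ∀ a b c d e → a * b * c + (a * d + e) ≡ a * (b * c + d) + e
  rearrange = solve-∀

series : CommutativeSemiring 0ℓ 0ℓ
series = record
  { Carrier = Series ; _≈_ = _≗_ ; _+_ = _⊕_ ; _*_ = _⊛_ ; 0# = 𝟘 ; 1# = 𝟙
  ; isCommutativeSemiring = isCommutativeSemiringˡ record
    { +-isCommutativeMonoid = isCommutativeMonoidˡ record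
      { isSemigroup = record
        { isMagma = record { isEquivalence = isEquivalence ; ∙-cong = λ p q n → cong₂ _+_ (p n) (q n) }
        ; assoc   = λ f g h n → +-assoc (f n) (g n) (h n)
        }
      ; identityˡ = λ _ _ → refl
      ; comm      = λ f g n → +-comm (f n) (g n)
      }
    ; *-isCommutativeMonoid = isCommutativeMonoidˡ record
      { isSemigroup = record
        { isMagma = record { isEquivalence = isEquivalence ; ∙-cong = ⊛-cong }
        ; assoc   = ⊛-assoc
        }
      ; identityˡ = ⊛-identityˡ
      ; comm      = ⊛-comm
      }
    ; distribʳ = ⊛-distribʳ
    ; zeroˡ    = ⊛-zeroˡ
    }
  }
  where
  open Biased {A = Series} _≗_
  open Setoid (ℕ →-setoid ℕ) using (isEquivalence)

open CommutativeSemiring series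
  using (+-cong; *-cong) renaming (refl to ≗-refl; trans to ≗-trans; sym to ≗-sym)
open SemiringSolver series using (_:+_; _:*_; _:=_; con) renaming (solve to solveSeries)

z⊛-suc : ∀ f n → (z ⊛ f) (suc n) ≡ f n
z⊛-suc f n = ⊛-identityˡ f n

-- The Euler operator z d/dz and the recurrence for the coefficients of `C`

θ : Series → Series
θ f n = n * f n

θ-z : θ z ≗ z
θ-z zero          = refl
θ-z (suc zero)    = refl
θ-z (suc (suc n)) = *-zeroʳ n

θ-⊕ : ∀ f g → θ (f ⊕ g) ≗ θ f ⊕ θ g
θ-⊕ f g n = *-distribˡ-+ n (f n) (g n)

θ-⊛ : ∀ f g → θ (f ⊛ g) ≗ θ f ⊛ g ⊕ f ⊛ θ g
θ-⊛ f g zero    = sym (*-zeroʳ (f 0))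
θ-⊛ f g (suc n)
  rewrite ⊛-distribʳ g (tail f) (θ (tail f)) n =
  begin
  suc n * (f 0 * g (suc n) + (tail f ⊛ g) n)
    ≡⟨ split n (f 0) (g (suc n)) ((tail f ⊛ g) n) ⟩
  ((tail f ⊛ g) n + f 0 * (suc n * g (suc n))) + n * (tail f ⊛ g) n
    ≡⟨ cong (((tail f ⊛ g) n + f 0 * (suc n * g (suc n))) +_) (θ-⊛ (tail f) g n) ⟩
  ((tail f ⊛ g) n + f 0 * (suc n * g (suc n))) + ((θ (tail f) ⊛ g) n + (tail f ⊛ θ g) n)
    ≡⟨ regroup ((tail f ⊛ g) n) (f 0 * (suc n * g (suc n))) ((θ (tail f) ⊛ g) n) ((tail f ⊛ θ g) n) ⟩
  ((tail f ⊛ g) n + (θ (tail f) ⊛ g) n) + (f 0 * (suc n * g (suc n)) + (tail f ⊛ θ g) n)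
    ∎
  where
  open ≡-Reasoning
  split : ∀ n a b c → suc n * (a * b + c) ≡ (c + a * (suc n * b)) + n * c
  split = solve-∀
  regroup : ∀ a b c d → (a + b) + (c + d) ≡ (a + c) + (b + d)
  regroup = solve-∀

θ-𝟙 : θ 𝟙 ≗ 𝟘
θ-𝟙 zero    = refl
θ-𝟙 (suc n) = *-zeroʳ n

θ-cong : ∀ {f g} → f ≗ g → θ f ≗ θ g
θ-cong p n = cong (n *_) (p n)

-- Write E₁ = M - z(1 + M + M²), Q = 1 - z - 2zM and E₂ = QC - 1.  In the ring of power series,
--   (1 - 2z - 3z²) θC - z(1 + 3z) C = Q θE₂ + 4z E₁ θC + 2z (E₁ + θE₁) C,
-- and `certificate` is this identity with the negative terms moved to the other side.
module Recurrence
  {M C : Series}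
  (M-eq : M ≗ z ⊛ (𝟙 ⊕ M ⊕ M ⊛ M))
  (C-eq : C ≗ 𝟙 ⊕ (z ⊕ z ⊛ M ⊕ z ⊛ M) ⊛ C)
  where

  private
    q = z ⊕ z ⊛ M ⊕ z ⊛ M
    M₁ = z ⊛ (𝟙 ⊕ M ⊕ M ⊛ M)
    θM₁ = z ⊛ (𝟙 ⊕ M ⊕ M ⊛ M) ⊕ z ⊛ (θ M ⊕ (θ M ⊛ M ⊕ M ⊛ θ M))
    θC₁ = (z ⊕ (z ⊛ M ⊕ z ⊛ θ M) ⊕ (z ⊛ M ⊕ z ⊛ θ M)) ⊛ C ⊕ q ⊛ θ C

    θM-eq : θ M ≗ θM₁
    θM-eq = ≗-trans (θ-cong M-eq) (≗-trans (θ-⊛ z _)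
      (+-cong (*-cong θ-z ≗-refl) (*-cong {z} ≗-refl
        (≗-trans (θ-⊕ (𝟙 ⊕ M) (M ⊛ M))
          (+-cong (≗-trans (θ-⊕ 𝟙 M) (+-cong {y = 𝟘} {u = θ M} θ-𝟙 ≗-refl)) (θ-⊛ M M))))))

    θq-eq : θ q ≗ z ⊕ (z ⊛ M ⊕ z ⊛ θ M) ⊕ (z ⊛ M ⊕ z ⊛ θ M)
    θq-eq = ≗-trans (θ-⊕ (z ⊕ z ⊛ M) (z ⊛ M))
      (+-cong (≗-trans (θ-⊕ z (z ⊛ M)) (+-cong θ-z θzM)) θzM)
      where
      θzM : θ (z ⊛ M) ≗ z ⊛ M ⊕ z ⊛ θ M
      θzM = ≗-trans (θ-⊛ z M) (+-cong (*-cong θ-z ≗-refl) ≗-refl)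

    θC-eq : θ C ≗ θC₁
    θC-eq = ≗-trans (θ-cong C-eq) (≗-trans (θ-⊕ 𝟙 (q ⊛ C))
      (+-cong {y = 𝟘} θ-𝟙 (≗-trans (θ-⊛ q C) (+-cong (*-cong θq-eq ≗-refl) ≗-refl))))

    2zC = z ⊛ C ⊕ z ⊛ C
    w = z ⊛ θ C ⊕ z ⊛ θ C ⊕ z ⊛ θ C ⊕ z ⊛ θ C ⊕ 2zC
    goalʳ = z ⊛ C ⊕ z ⊛ θ C ⊕ z ⊛ θ C ⊕ z ⊛ z ⊛ (C ⊕ C ⊕ C ⊕ θ C ⊕ θ C ⊕ θ C)

    certificate :
      θ C ⊕ (θC₁ ⊕ q ⊛ θ C ⊕ w ⊛ M₁ ⊕ 2zC ⊛ θM₁) ≗ goalʳ ⊕ (θ C ⊕ q ⊛ θC₁ ⊕ w ⊛ M ⊕ 2zC ⊛ θ M)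
    certificate = solveSeries 5 (λ z M C θM θC →
      let q   = z :+ z :* M :+ z :* M
          M₁  = z :* (con 1 :+ M :+ M :* M)
          θM₁ = z :* (con 1 :+ M :+ M :* M) :+ z :* (θM :+ (θM :* M :+ M :* θM))
          θC₁ = (z :+ (z :* M :+ z :* θM) :+ (z :* M :+ z :* θM)) :* C :+ q :* θC
          2zC = z :* C :+ z :* C
          w   = z :* θC :+ z :* θC :+ z :* θC :+ z :* θC :+ 2zC
      in θC :+ (θC₁ :+ q :* θC :+ w :* M₁ :+ 2zC :* θM₁)
           := z :* C :+ z :* θC :+ z :* θC :+ z :* z :* (C :+ C :+ C :+ θC :+ θC :+ θC)
              :+ (θC :+ q :* θC₁ :+ w :* M :+ 2zC :* θM))
      (λ _ → refl) z M C (θ M) (θ C)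

    -- This is the first-order differential equation of (1 - 2z - 3z²)^(-1/2). The sums in
    -- parentheses in `certificate` agree term by term by the equations for `M` and `C` and their
    -- images under `θ`, so they cancel.
    θC≗goalʳ : θ C ≗ goalʳ
    θC≗goalʳ n = +-cancelʳ-≡ _ _ _ (trans (certificate n) (cong (goalʳ n +_) (swap n)))
      where
      swap : θ C ⊕ q ⊛ θC₁ ⊕ w ⊛ M ⊕ 2zC ⊛ θ M ≗ θC₁ ⊕ q ⊛ θ C ⊕ w ⊛ M₁ ⊕ 2zC ⊛ θM₁
      swap = +-cong (+-cong (+-cong θC-eq (*-cong {q} ≗-refl (≗-sym θC-eq)))
                            (*-cong {w} ≗-refl M-eq)) (*-cong {2zC} ≗-refl θM-eq)

  C₀≡1 : C 0 ≡ 1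
  C₀≡1 = C-eq 0

  private
    z⊛z⊛-suc² : ∀ f n → (z ⊛ z ⊛ f) (2 + n) ≡ f n
    z⊛z⊛-suc² f n = trans (⊛-assoc z z f (2 + n)) (trans (z⊛-suc (z ⊛ f) (1 + n)) (z⊛-suc f n))

  C₁≡1 : C 1 ≡ 1
  C₁≡1 = trans (sym (*-identityˡ (C 1))) (trans (θC≗goalʳ 1) goalʳ≡1)
    where
    goalʳ≡1 : goalʳ 1 ≡ 1
    goalʳ≡1 rewrite C₀≡1 = refl

  recurrence : ∀ n → (2 + n) * C (2 + n) ≡ (3 + 2 * n) * C (1 + n) + 3 * (1 + n) * C n
  recurrence n = trans (θC≗goalʳ (2 + n)) (trans
    (cong₂ _+_ (cong₂ _+_ (cong₂ _+_ (z⊛-suc C (1 + n)) (z⊛-suc (θ C) (1 + n))) (z⊛-suc (θ C) (1 + n)))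
               (z⊛z⊛-suc² (C ⊕ C ⊕ C ⊕ θ C ⊕ θ C ⊕ θ C) n))
    (collect n (C (1 + n)) (C n)))
    where
    collect : ∀ n a b → a + (1 + n) * a + (1 + n) * a + (b + b + b + n * b + n * b + n * b)
                        ≡ (3 + 2 * n) * a + 3 * (1 + n) * b
    collect = solve-∀

  -- The two bounds feed each other through the recurrence: the upper one needs `C n` to be small
  -- against `C (1 + n)`, which is the lower one at the previous index, and conversely. The lower
  -- bound puts the ratio at 3 - 2/(n + 1) or more, hence the limit 3.
  ratio-bounds : ∀ n → C (1 + n) ≤ 3 * C n × (1 + 3 * n) * C n ≤ (1 + n) * C (1 + n)
  ratio-bounds zero =
    subst₂ (λ c₀ c₁ → c₁ ≤ 3 * c₀ × 1 * c₀ ≤ 1 * c₁) (sym C₀≡1) (sym C₁≡1) (s≤s z≤n , ≤-refl)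
  ratio-bounds (suc n) with upper , lower ← ratio-bounds n = upper′ , lower′
    where
    open ≤-Reasoning
    a = C (1 + n)
    b = C n

    b≤a : 3 * (1 + n) * b ≤ (3 + n) * a
    b≤a = *-cancelˡ-≤ (1 + n) (begin
      (1 + n) * (3 * (1 + n) * b)                    ≤⟨ m≤m+n _ (4 * n * b) ⟩
      (1 + n) * (3 * (1 + n) * b) + 4 * n * b        ≡⟨ factor n b ⟩
      (3 + n) * ((1 + 3 * n) * b)                    ≤⟨ *-monoʳ-≤ (3 + n) lower ⟩
      (3 + n) * ((1 + n) * a)                        ≡⟨ swap (3 + n) (1 + n) a ⟩
      (1 + n) * ((3 + n) * a)                        ∎)
      where
      factor : ∀ n b → (1 + n) * (3 * (1 + n) * b) + 4 * n * b ≡ (3 + n) * ((1 + 3 * n) * b)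
      factor = solve-∀
      swap : ∀ x y a → x * (y * a) ≡ y * (x * a)
      swap = solve-∀

    upper′ : C (2 + n) ≤ 3 * a
    upper′ = *-cancelˡ-≤ (2 + n) (begin
      (2 + n) * C (2 + n)                            ≡⟨ recurrence n ⟩
      (3 + 2 * n) * a + 3 * (1 + n) * b              ≤⟨ +-monoʳ-≤ ((3 + 2 * n) * a) b≤a ⟩
      (3 + 2 * n) * a + (3 + n) * a                  ≡⟨ collect n a ⟩
      (2 + n) * (3 * a)                              ∎)
      where
      collect : ∀ n a → (3 + 2 * n) * a + (3 + n) * a ≡ (2 + n) * (3 * a)
      collect = solve-∀

    lower′ : (1 + 3 * (1 + n)) * a ≤ (2 + n) * C (2 + n)
    lower′ = begin
      (1 + 3 * (1 + n)) * a                          ≡⟨ split n a ⟩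
      (3 + 2 * n) * a + (1 + n) * a                  ≤⟨ +-monoʳ-≤ ((3 + 2 * n) * a) (*-monoʳ-≤ (1 + n) upper) ⟩
      (3 + 2 * n) * a + (1 + n) * (3 * b)            ≡⟨ cong ((3 + 2 * n) * a +_) (swap n b) ⟩
      (3 + 2 * n) * a + 3 * (1 + n) * b              ≡⟨ recurrence n ⟨
      (2 + n) * C (2 + n)                            ∎
      where
      split : ∀ n a → (1 + 3 * (1 + n)) * a ≡ (3 + 2 * n) * a + (1 + n) * a
      split = solve-∀
      swap : ∀ n b → (1 + n) * (3 * b) ≡ 3 * (1 + n) * b
      swap = solve-∀

  ratio-≤3 : ∀ n → C (1 + n) ≤ 3 * C n
  ratio-≤3 n = proj₁ (ratio-bounds n)

  ratio-≥2 : ∀ n → 2 * C (1 + n) ≤ C (2 + n)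
  ratio-≥2 n = *-cancelˡ-≤ (2 + n) (begin
    (2 + n) * (2 * C (1 + n))                        ≤⟨ m≤m+n _ (n * C (1 + n)) ⟩
    (2 + n) * (2 * C (1 + n)) + n * C (1 + n)        ≡⟨ collect n (C (1 + n)) ⟩
    (1 + 3 * (1 + n)) * C (1 + n)                    ≤⟨ proj₂ (ratio-bounds (1 + n)) ⟩
    (2 + n) * C (2 + n)                              ∎)
    where
    open ≤-Reasoning
    collect : ∀ n a → (2 + n) * (2 * a) + n * a ≡ (1 + 3 * (1 + n)) * a
    collect = solve-∀

  -- As d ≤ 3a - 1, the fraction d/a is at most 3 - 1/a, and 2/(n + 1) ≤ 1/a once n ≥ 2a.
  ratio→3 : ∀ a d → d < 3 * a → ∀ n → 2 * a ≤ n → d * C n ≤ a * C (1 + n)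
  ratio→3 a d d<3a n 2a≤n = *-cancelˡ-≤ (3 * (1 + n)) (begin
    3 * (1 + n) * (d * C n)                          ≤⟨ +-cancelʳ-≤ (6 * a * C n) _ _ (begin
      3 * (1 + n) * (d * C n) + 6 * a * C n            ≡⟨ regroup n d a (C n) ⟩
      (3 * n * d + (3 * d + 3 * (2 * a))) * C n        ≤⟨ *-monoˡ-≤ (C n) (+-monoʳ-≤ (3 * n * d)
                                                            (+-monoʳ-≤ (3 * d) (*-monoʳ-≤ 3 2a≤n))) ⟩
      (3 * n * d + (3 * d + 3 * n)) * C n              ≤⟨ m≤m+n _ (3 * C n) ⟩
      (3 * n * d + (3 * d + 3 * n)) * C n + 3 * C n    ≡⟨ regroup′ n d (C n) ⟩
      3 * (1 + n) * (1 + d) * C n                      ≤⟨ *-monoˡ-≤ (C n) (*-monoʳ-≤ (3 * (1 + n)) d<3a) ⟩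
      3 * (1 + n) * (3 * a) * C n                      ≡⟨ regroup″ n a (C n) ⟩
      3 * a * ((1 + 3 * n) * C n) + 6 * a * C n        ∎) ⟩
    3 * a * ((1 + 3 * n) * C n)                      ≤⟨ *-monoʳ-≤ (3 * a) (proj₂ (ratio-bounds n)) ⟩
    3 * a * ((1 + n) * C (1 + n))                    ≡⟨ swap n a (C (1 + n)) ⟩
    3 * (1 + n) * (a * C (1 + n))                    ∎)
    where
    open ≤-Reasoning
    regroup : ∀ n d a c → 3 * (1 + n) * (d * c) + 6 * a * c ≡ (3 * n * d + (3 * d + 3 * (2 * a))) * c
    regroup = solve-∀
    regroup′ : ∀ n d c → (3 * n * d + (3 * d + 3 * n)) * c + 3 * c ≡ 3 * (1 + n) * (1 + d) * c
    regroup′ = solve-∀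
    regroup″ : ∀ n a c → 3 * (1 + n) * (3 * a) * c ≡ 3 * a * ((1 + 3 * n) * c) + 6 * a * c
    regroup″ = solve-∀
    swap : ∀ n a c → 3 * a * ((1 + n) * c) ≡ 3 * (1 + n) * (a * c)
    swap = solve-∀

-- Finite sums

∑ : ℕ → (ℕ → ℕ) → ℕ
∑ zero    f = 0
∑ (suc N) f = ∑ N f + f N

∑-zero : ∀ N {f} → (∀ k → k < N → f k ≡ 0) → ∑ N f ≡ 0
∑-zero zero    f≡0 = refl
∑-zero (suc N) f≡0 = cong₂ _+_ (∑-zero N (λ k k<N → f≡0 k (m<n⇒m<1+n k<N))) (f≡0 N ≤-refl)

∑-single : ∀ N {f} j → j < N → (∀ k → k ≢ j → f k ≡ 0) → ∑ N f ≡ f j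
∑-single (suc N) {f} j j<1+N f≡0 with m≤n⇒m<n∨m≡n (s≤s⁻¹ j<1+N)
... | inj₁ j<N  = trans (cong₂ _+_ (∑-single N j j<N f≡0) (f≡0 N (>⇒≢ j<N))) (+-identityʳ (f j))
... | inj₂ refl = cong (_+ f N) (∑-zero N (λ k k<N → f≡0 k (<⇒≢ k<N)))

∑-weighted-+ : ∀ N (w f g : ℕ → ℕ) →
  ∑ N (λ k → w k * (f k + g k)) ≡ ∑ N (λ k → w k * f k) + ∑ N (λ k → w k * g k)
∑-weighted-+ zero    w f g = refl
∑-weighted-+ (suc N) w f g rewrite ∑-weighted-+ N w f g =
  rearrange (∑ N (λ k → w k * f k)) (∑ N (λ k → w k * g k)) (w N) (f N) (g N)
  where
  rearrange : ∀ a b w x y → (a + b) + w * (x + y) ≡ (a + w * x) + (b + w * y)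
  rearrange = solve-∀

sum-∑-swap : ∀ {A : Set} N (w : ℕ → ℕ) (f : ℕ → A → ℕ) xs →
  sum (List.map (λ x → ∑ N (λ k → w k * f k x)) xs) ≡ ∑ N (λ k → w k * sum (List.map (f k) xs))
sum-∑-swap N w f []       = sym (∑-zero N (λ k _ → *-zeroʳ (w k)))
sum-∑-swap N w f (x ∷ xs) = trans
  (cong (∑ N (λ k → w k * f k x) +_) (sum-∑-swap N w f xs))
  (sym (∑-weighted-+ N w (λ k → f k x) (λ k → sum (List.map (f k) xs))))

sum-map-+ : ∀ {A : Set} (f g : A → ℕ) xs →
  sum (List.map (λ x → f x + g x) xs) ≡ sum (List.map f xs) + sum (List.map g xs)
sum-map-+ f g []       = refl
sum-map-+ f g (x ∷ xs) rewrite sum-map-+ f g xs =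
  rearrange (f x) (g x) (sum (List.map f xs)) (sum (List.map g xs))
  where
  rearrange : ∀ a b c d → (a + b) + (c + d) ≡ (a + c) + (b + d)
  rearrange = solve-∀

sum-map-concatMap : ∀ {A B : Set} (g : B → ℕ) (f : A → List B) xs →
  sum (List.map g (concatMap f xs)) ≡ sum (List.map (λ x → sum (List.map g (f x))) xs)
sum-map-concatMap g f []       = refl
sum-map-concatMap g f (x ∷ xs)
  rewrite map-++ g (f x) (concatMap f xs) | sum-++ (List.map g (f x)) (List.map g (concatMap f xs))
  = cong (sum (List.map g (f x)) +_) (sum-map-concatMap g f xs)

sum-map-filter : ∀ {A : Set} {P : A → Set} (P? : Decidable P) (f : A → ℕ) xs →
  sum (List.map f (filter P? xs)) ≡ sum (List.map (λ x → if does (P? x) then f x else 0) xs)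
sum-map-filter P? f []       = refl
sum-map-filter P? f (x ∷ xs) with P? x
... | yes _ = cong (f x +_) (sum-map-filter P? f xs)
... | no  _ = sum-map-filter P? f xs

length-sum : ∀ {A : Set} (xs : List A) → length xs ≡ sum (List.map (const 1) xs)
length-sum []       = refl
length-sum (x ∷ xs) = cong suc (length-sum xs)

sum-map-scale : ∀ {A : Set} a (f : A → ℕ) xs → sum (List.map (λ x → a * f x) xs) ≡ a * sum (List.map f xs)
sum-map-scale a f []       = sym (*-zeroʳ a)
sum-map-scale a f (x ∷ xs) rewrite sum-map-scale a f xs = sym (*-distribˡ-+ a (f x) _)

sum-cartesianProduct : ∀ {A B C : Set} (f : A → B → C) {g : C → ℕ} {p : A → ℕ} {q : B → ℕ} →
  (∀ x y → g (f x y) ≡ p x * q y) → ∀ xs ys →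
  sum (List.map g (cartesianProductWith f xs ys)) ≡ sum (List.map p xs) * sum (List.map q ys)
sum-cartesianProduct f g≡pq [] ys = refl
sum-cartesianProduct f {g} {p} {q} g≡pq (x ∷ xs) ys = begin
  sum (List.map g (List.map (f x) ys ++ rest))
    ≡⟨ cong sum (map-++ g (List.map (f x) ys) rest) ⟩
  sum (List.map g (List.map (f x) ys) ++ List.map g rest)
    ≡⟨ sum-++ (List.map g (List.map (f x) ys)) (List.map g rest) ⟩
  sum (List.map g (List.map (f x) ys)) + sum (List.map g rest)
    ≡⟨ cong₂ _+_ (trans (cong sum (trans (sym (map-∘ ys)) (map-cong (g≡pq x) ys))) (sum-map-scale (p x) q ys))
                 (sum-cartesianProduct f g≡pq xs ys) ⟩
  p x * sum (List.map q ys) + sum (List.map p xs) * sum (List.map q ys)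
    ≡⟨ *-distribʳ-+ (sum (List.map q ys)) (p x) (sum (List.map p xs)) ⟨
  (p x + sum (List.map p xs)) * sum (List.map q ys) ∎
  where
  open ≡-Reasoning
  rest = cartesianProductWith f xs ys

⊛-as-sum : ∀ f g n → sum (List.map (λ i → f i * g (n ∸ i)) (upTo (suc n))) ≡ (f ⊛ g) n
⊛-as-sum f g n = trans (cong sum (map-applyUpTo id (λ i → f i * g (n ∸ i)) (suc n))) (unfold f n)
  where
  unfold : ∀ f n → sum (applyUpTo (λ i → f i * g (n ∸ i)) (suc n)) ≡ (f ⊛ g) n
  unfold f zero    = +-identityʳ (f 0 * g 0)
  unfold f (suc n) = cong (f 0 * g (suc n) +_) (unfold (tail f) n)

-- Generating functions of trees

total : (Tree → ℕ) → Series
total g n = sum (List.map g (trees n))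

-- The additive functional with toll function `g`.
marked : (Tree → ℕ) → Tree → ℕ
marked g leaf         = g leaf
marked g (unary t)    = g (unary t) + marked g t
marked g (binary l r) = g (binary l r) + (marked g l + marked g r)

-- The enumeration at size n + 1 lists all smaller trees with fuel n; this lets them be read as
-- `trees i`.
treesWithin-fuel : ∀ f f′ n → n ≤ f → n ≤ f′ → treesWithin f n ≡ treesWithin f′ n
treesWithin-fuel zero    zero     zero    _ _ = refl
treesWithin-fuel zero    (suc f′) zero    _ _ = refl
treesWithin-fuel (suc f) zero     zero    _ _ = refl
treesWithin-fuel (suc f) (suc f′) zero    _ _ = refl
treesWithin-fuel (suc f) (suc f′) (suc n) (s≤s n≤f) (s≤s n≤f′) =
  cong (leafIfEmpty n ++_) (cong₂ _++_
    (cong (List.map unary) (treesWithin-fuel f f′ n n≤f n≤f′))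
    (cong List.concat (map-cong-local (All.tabulate λ {i} i∈ → let i≤n = s≤s⁻¹ (∈-upTo⁻ i∈) in
      cong₂ (cartesianProductWith binary)
        (treesWithin-fuel f f′ i (≤-trans i≤n n≤f) (≤-trans i≤n n≤f′))
        (treesWithin-fuel f f′ (n ∸ i) (≤-trans (m∸n≤m n i) n≤f) (≤-trans (m∸n≤m n i) n≤f′))))))

total-+ : ∀ f g → total (λ t → f t + g t) ≗ total f ⊕ total g
total-+ f g n = sum-map-+ f g (trees n)

total-cong : ∀ {f g} → f ≗ g → total f ≗ total g
total-cong f≗g n = cong sum (map-cong f≗g (trees n))

-- The symbolic method: one summand per constructor. The weights of the children may differ from `g`
-- and from each other, and `A` records whether a leaf counts.
total-rec : ∀ {g p q r} {A : Series} → (∀ n → sum (List.map g (leafIfEmpty n)) ≡ A n) →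
  (∀ t → g (unary t) ≡ p t) → (∀ s t → g (binary s t) ≡ q s * r t) →
  total g ≗ z ⊛ (A ⊕ total p ⊕ total q ⊛ total r)
total-rec _ _ _ zero = refl
total-rec {g} {p} {q} {r} {A} g-leaf g-unary g-binary (suc n) = begin
  sum (List.map g (leafIfEmpty n ++ us ++ bs))
    ≡⟨ cong sum (trans (map-++ g (leafIfEmpty n) (us ++ bs))
                       (cong (List.map g (leafIfEmpty n) ++_) (map-++ g us bs))) ⟩
  sum (List.map g (leafIfEmpty n) ++ List.map g us ++ List.map g bs)
    ≡⟨ trans (sum-++ (List.map g (leafIfEmpty n)) _)
             (cong (sum (List.map g (leafIfEmpty n)) +_) (sum-++ (List.map g us) (List.map g bs))) ⟩
  sum (List.map g (leafIfEmpty n)) + (sum (List.map g us) + sum (List.map g bs))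
    ≡⟨ +-assoc (sum (List.map g (leafIfEmpty n))) _ _ ⟨
  sum (List.map g (leafIfEmpty n)) + sum (List.map g us) + sum (List.map g bs)
    ≡⟨ cong₂ _+_ (cong₂ _+_ (g-leaf n) (cong sum (trans (sym (map-∘ (trees n))) (map-cong g-unary (trees n)))))
                 binaries ⟩
  (A ⊕ total p ⊕ total q ⊛ total r) n
    ≡⟨ z⊛-suc (A ⊕ total p ⊕ total q ⊛ total r) n ⟨
  (z ⊛ (A ⊕ total p ⊕ total q ⊛ total r)) (suc n) ∎
  where
  open ≡-Reasoning
  split = λ i → cartesianProductWith binary (treesWithin n i) (treesWithin n (n ∸ i))
  us    = List.map unary (trees n)
  bs    = concatMap split (upTo (suc n))

  split-total : ∀ {i} → i ≤ n → sum (List.map g (split i)) ≡ total q i * total r (n ∸ i)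
  split-total {i} i≤n = trans (sum-cartesianProduct binary g-binary (treesWithin n i) (treesWithin n (n ∸ i)))
    (cong₂ (λ ss ts → sum (List.map q ss) * sum (List.map r ts))
      (treesWithin-fuel n i i i≤n ≤-refl) (treesWithin-fuel n (n ∸ i) (n ∸ i) (m∸n≤m n i) ≤-refl))

  binaries : sum (List.map g bs) ≡ (total q ⊛ total r) n
  binaries = trans (sum-map-concatMap g split (upTo (suc n)))
    (trans (cong sum (map-cong-local (All.tabulate λ i∈ → split-total (s≤s⁻¹ (∈-upTo⁻ i∈)))))
      (⊛-as-sum (total q) (total r) n))

total-0 : total (const 0) ≗ 𝟘
total-0 n = trans (sum-map-scale 0 (const 0) (trees n)) refl

M : Series
M = total (const 1)

M-eq : M ≗ z ⊛ (𝟙 ⊕ M ⊕ M ⊛ M)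
M-eq = total-rec (λ { zero → refl ; (suc _) → refl }) (λ _ → refl) (λ _ _ → refl)

-- One step on the path from the root to a marked vertex: through a unary vertex, or through a
-- binary one with the sibling subtree on either side. Hence `C` is formally 1 / (1 - `spine`).
spine : Series
spine = z ⊕ z ⊛ M ⊕ z ⊛ M

marked-eq : ∀ g → total (marked g) ≗ total g ⊕ spine ⊛ total (marked g)
marked-eq g = ≗-trans (total-cong marked-split) (≗-trans (total-+ g (λ t → inUnaryOrLeft t + inRight t))
  (+-cong {total g} ≗-refl (≗-trans (total-+ inUnaryOrLeft inRight) (≗-trans (+-cong left-eq right-eq) factor))))
  where
  -- `total-rec` wants a product at binary vertices, whereas `marked` adds there. Each of the two
  -- summands is a product with the constant weight 1, which contributes the factor `M`.
  inUnaryOrLeft inRight : Tree → ℕ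
  inUnaryOrLeft leaf         = 0
  inUnaryOrLeft (unary t)    = marked g t
  inUnaryOrLeft (binary l r) = marked g l * 1
  inRight leaf         = 0
  inRight (unary t)    = 0
  inRight (binary l r) = 1 * marked g r

  marked-split : ∀ t → marked g t ≡ g t + (inUnaryOrLeft t + inRight t)
  marked-split leaf         = sym (+-identityʳ (g leaf))
  marked-split (unary t)    = cong (g (unary t) +_) (sym (+-identityʳ (marked g t)))
  marked-split (binary l r) = cong (g (binary l r) +_)
    (cong₂ _+_ (sym (*-identityʳ (marked g l))) (sym (*-identityˡ (marked g r))))

  B = total (marked g)

  left-eq : total inUnaryOrLeft ≗ z ⊛ (𝟘 ⊕ B ⊕ B ⊛ M)
  left-eq = total-rec (λ { zero → refl ; (suc _) → refl }) (λ _ → refl) (λ _ _ → refl)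

  right-eq : total inRight ≗ z ⊛ (𝟘 ⊕ 𝟘 ⊕ M ⊛ B)
  right-eq = ≗-trans (total-rec {p = const 0} {A = 𝟘} (λ { zero → refl ; (suc _) → refl }) (λ _ → refl) (λ _ _ → refl))
    (*-cong {z} ≗-refl (+-cong (λ n → total-0 n) ≗-refl))

  factor : z ⊛ (𝟘 ⊕ B ⊕ B ⊛ M) ⊕ z ⊛ (𝟘 ⊕ 𝟘 ⊕ M ⊛ B) ≗ spine ⊛ B
  factor = solveSeries 3 (λ z M B →
    z :* (con 0 :+ B :+ B :* M) :+ z :* (con 0 :+ con 0 :+ M :* B) := (z :+ z :* M :+ z :* M) :* B)
    (λ _ → refl) z M B

-- An indicator function in arithmetic form: being a product at binary vertices, it is a weight to
-- which `total-rec` applies.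
uniformAt : ℕ → Tree → ℕ
uniformAt zero    leaf         = 1
uniformAt zero    (unary _)    = 0
uniformAt zero    (binary _ _) = 0
uniformAt (suc k) leaf         = 0
uniformAt (suc k) (unary t)    = uniformAt k t
uniformAt (suc k) (binary l r) = uniformAt k l * uniformAt k r

U : ℕ → Series
U k = total (uniformAt k)

U-zero : U 0 ≗ z
U-zero = ≗-trans (total-rec {p = const 0} {q = const 0} {r = const 0} {A = 𝟙}
    (λ { zero → refl ; (suc _) → refl }) (λ _ → refl) (λ _ _ → refl))
  (≗-trans (*-cong {z} ≗-refl (+-cong (+-cong {𝟙} ≗-refl total-0) (*-cong total-0 total-0)))
    (solveSeries 1 (λ z → z :* (con 1 :+ con 0 :+ con 0 :* con 0) := z) (λ _ → refl) z))

U-suc : ∀ k → U (suc k) ≗ z ⊛ (U k ⊕ U k ⊛ U k)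
U-suc k = ≗-trans
  (total-rec {A = 𝟘} (λ { zero → refl ; (suc _) → refl }) (λ _ → refl) (λ _ _ → refl))
  (λ _ → refl)

-- `C n` counts the trees with n vertices besides one marked leaf, i.e. the possible surroundings of a subtree.
C : Series
C = tail (total (marked (uniformAt 0)))

markedLeaf : total (marked (uniformAt 0)) ≗ z ⊛ C
markedLeaf zero    = refl
markedLeaf (suc n) = sym (z⊛-suc C n)

C-eq : C ≗ 𝟙 ⊕ spine ⊛ C
C-eq n = trans (trans (sym (z⊛-suc C n)) (z⊛C-eq (suc n))) (z⊛-suc (𝟙 ⊕ spine ⊛ C) n)
  where
  z⊛C-eq : z ⊛ C ≗ z ⊛ (𝟙 ⊕ spine ⊛ C)
  z⊛C-eq = ≗-trans (≗-sym markedLeaf) (≗-trans (marked-eq (uniformAt 0))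
    (≗-trans (+-cong U-zero (*-cong {spine} ≗-refl markedLeaf))
      (solveSeries 3 (λ z q C → z :+ q :* (z :* C) := z :* (con 1 :+ q :* C)) (λ _ → refl) z spine C)))

-- Formally both sides are `total g` / (1 - `spine`). Without inverses, the product of
-- `total (marked g)` and `C` is expanded once by the equation of each factor, and the common term
-- cancels.
total-marked : ∀ g → total (marked g) ≗ total g ⊛ C
total-marked g n = sym (+-cancelʳ-≡ ((spine ⊛ (B ⊛ C)) n) _ _ (cancellable n))
  where
  B = total (marked g)
  G = total g
  cancellable : G ⊛ C ⊕ spine ⊛ (B ⊛ C) ≗ B ⊕ spine ⊛ (B ⊛ C)
  cancellable = ≗-trans
    (solveSeries 4 (λ G C q B → G :* C :+ q :* (B :* C) := (G :+ q :* B) :* C) (λ _ → refl) G C spine B)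
    (≗-trans (*-cong (≗-sym (marked-eq g)) ≗-refl) (≗-trans (*-cong {B} ≗-refl C-eq)
      (solveSeries 3 (λ B q C → B :* (con 1 :+ q :* C) := B :+ q :* (B :* C)) (λ _ → refl) B spine C)))

open Recurrence M-eq C-eq public

-- Balanced vertices

height : Tree → ℕ
height t = ∥ proj₁ (shortestPath t) ∥

AllAt : ℕ → Tree → Set
AllAt k t = (p : Path t) → ∥ p ∥ ≡ k

uniformAt-01 : ∀ k t → (uniformAt k t ≡ 1 × AllAt k t) ⊎ (uniformAt k t ≡ 0 × ¬ AllAt k t)
uniformAt-01 zero leaf = inj₁ (refl , λ { stop → refl })
uniformAt-01 zero (unary t) = inj₂ (refl , λ all → 1+n≢0 (all (down (proj₁ (shortestPath t)))))
uniformAt-01 zero (binary l r) = inj₂ (refl , λ all → 1+n≢0 (all (downˡ (proj₁ (shortestPath l)))))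
uniformAt-01 (suc k) leaf = inj₂ (refl , λ all → 0≢1+n (all stop))
uniformAt-01 (suc k) (unary t) with uniformAt-01 k t
... | inj₁ (eq , all)  = inj₁ (eq , λ { (down p) → cong suc (all p) })
... | inj₂ (eq , ¬all) = inj₂ (eq , λ all → ¬all (λ p → suc-injective (all (down p))))
uniformAt-01 (suc k) (binary l r) with uniformAt-01 k l | uniformAt-01 k r
... | inj₂ (eq , ¬all) | _ =
      inj₂ (cong (_* uniformAt k r) eq , λ all → ¬all (λ p → suc-injective (all (downˡ p))))
... | inj₁ _ | inj₂ (eq , ¬all) =
      inj₂ (trans (cong (uniformAt k l *_) eq) (*-zeroʳ (uniformAt k l))
           , λ all → ¬all (λ p → suc-injective (all (downʳ p))))
... | inj₁ (eq , all) | inj₁ (eq′ , all′) =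
      inj₁ (cong₂ _*_ eq eq′ , λ { (downˡ p) → cong suc (all p) ; (downʳ p) → cong suc (all′ p) })

path<size : ∀ {t} (p : Path t) → ∥ p ∥ < size t
path<size stop = s≤s z≤n
path<size (down p) = s≤s (path<size p)
path<size {binary l r} (downˡ p) = s≤s (≤-trans (path<size p) (m≤m+n (size l) (size r)))
path<size {binary l r} (downʳ p) = s≤s (≤-trans (path<size p) (m≤n+m (size r) (size l)))

uniformWeight : (ℕ → ℕ) → Tree → ℕ
uniformWeight w t = if does (uniform? t) then w (height t) else 0

-- At most one k contributes, namely the height, and it lies below N because a path has fewer edges
-- than the tree has vertices.
uniformWeight-∑ : ∀ w t N → size t ≤ N → uniformWeight w t ≡ ∑ N (λ k → w k * uniformAt k t)
uniformWeight-∑ w t N size≤N with uniform? t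
... | no ¬u = sym (∑-zero N λ k _ → trans (cong (w k *_) (vanish k)) (*-zeroʳ (w k)))
  where
  vanish : ∀ k → uniformAt k t ≡ 0
  vanish k with uniformAt-01 k t
  ... | inj₁ (_ , all) = ⊥-elim (¬u (λ p p′ → trans (all p) (sym (all p′))))
  ... | inj₂ (eq , _)  = eq
... | yes u = sym (trans
    (∑-single N h (≤-trans (path<size p) size≤N) λ k k≢h → trans (cong (w k *_) (vanish k k≢h)) (*-zeroʳ (w k)))
    (trans (cong (w h *_) full) (*-identityʳ (w h))))
  where
  p = proj₁ (shortestPath t)
  h = height t
  vanish : ∀ k → k ≢ h → uniformAt k t ≡ 0
  vanish k k≢h with uniformAt-01 k t
  ... | inj₁ (_ , all) = ⊥-elim (k≢h (sym (all p)))
  ... | inj₂ (eq , _)  = eq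
  full : uniformAt h t ≡ 1
  full with uniformAt-01 h t
  ... | inj₁ (eq , _)   = eq
  ... | inj₂ (_ , ¬all) = ⊥-elim (¬all (λ p′ → u p′ p))

marked-∑ : ∀ w t N → size t ≤ N →
  marked (uniformWeight w) t ≡ ∑ N (λ k → w k * marked (uniformAt k) t)
marked-∑ w leaf N 1≤N = uniformWeight-∑ w leaf N 1≤N
marked-∑ w (unary t) N size≤N = trans
  (cong₂ _+_ (uniformWeight-∑ w (unary t) N size≤N) (marked-∑ w t N (≤-trans (n≤1+n _) size≤N)))
  (sym (∑-weighted-+ N w _ _))
marked-∑ w (binary l r) N size≤N = trans
  (cong₂ _+_ (uniformWeight-∑ w (binary l r) N size≤N)
    (trans (cong₂ _+_ (marked-∑ w l N (≤-trans (≤-trans (m≤m+n _ (size r)) (n≤1+n _)) size≤N))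
                      (marked-∑ w r N (≤-trans (≤-trans (m≤n+m _ (size l)) (n≤1+n _)) size≤N)))
           (sym (∑-weighted-+ N w _ _))))
  (sym (∑-weighted-+ N w _ _))

marked-vertices : ∀ g t → sum (List.map (λ v → g (subtree v)) (vertices t)) ≡ marked g t
marked-vertices g leaf      = +-identityʳ (g leaf)
marked-vertices g (unary t) =
  cong (g (unary t) +_) (trans (cong sum (sym (map-∘ (vertices t)))) (marked-vertices g t))
marked-vertices g (binary l r) = cong (g (binary l r) +_) (begin
  sum (List.map g∘subtree (List.map left (vertices l) ++ List.map right (vertices r)))
    ≡⟨ cong sum (map-++ g∘subtree (List.map left (vertices l)) (List.map right (vertices r))) ⟩
  sum (List.map g∘subtree (List.map left (vertices l)) ++ List.map g∘subtree (List.map right (vertices r)))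
    ≡⟨ sum-++ (List.map g∘subtree (List.map left (vertices l))) _ ⟩
  sum (List.map g∘subtree (List.map left (vertices l))) + sum (List.map g∘subtree (List.map right (vertices r)))
    ≡⟨ cong₂ _+_ (trans (cong sum (sym (map-∘ (vertices l)))) (marked-vertices g l))
                 (trans (cong sum (sym (map-∘ (vertices r)))) (marked-vertices g r)) ⟩
  marked g l + marked g r ∎)
  where
  open ≡-Reasoning
  g∘subtree : Vertex (binary l r) → ℕ
  g∘subtree v = g (subtree v)

sum-balancedPairs : ∀ w n →
  sum (List.map (λ x → w (rank (proj₂ x))) (balancedPairs n)) ≡ ∑ n (λ k → w k * (U k ⊛ C) n)
sum-balancedPairs w n = begin
  sum (List.map (λ x → w (rank (proj₂ x))) (balancedPairs n))
    ≡⟨ sum-map-filter (λ x → balanced? (proj₂ x)) (λ x → w (rank (proj₂ x))) (pointedTrees n) ⟩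
  sum (List.map weight (pointedTrees n))
    ≡⟨ sum-map-concatMap weight (λ t → List.map (t ,_) (vertices t)) (trees n) ⟩
  sum (List.map (λ t → sum (List.map weight (List.map (t ,_) (vertices t)))) (trees n))
    ≡⟨ cong sum (map-cong (λ t → trans (cong sum (sym (map-∘ (vertices t)))) (marked-vertices (uniformWeight w) t))
                          (trees n)) ⟩
  sum (List.map (marked (uniformWeight w)) (trees n))
    ≡⟨ cong sum (map-cong-local (All.tabulate λ {t} t∈ →
         marked-∑ w t n (≤-reflexive (Equivalence.to ∈-trees t∈)))) ⟩
  sum (List.map (λ t → ∑ n (λ k → w k * marked (uniformAt k) t)) (trees n))
    ≡⟨ sum-∑-swap n w (λ k → marked (uniformAt k)) (trees n) ⟩
  ∑ n (λ k → w k * total (marked (uniformAt k)) n)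
    ≡⟨ ∑-cong n (λ k → cong (w k *_) (total-marked (uniformAt k) n)) ⟩
  ∑ n (λ k → w k * (U k ⊛ C) n) ∎
  where
  open ≡-Reasoning
  weight : PointedTree → ℕ
  weight x = uniformWeight w (subtree (proj₂ x))
  ∑-cong : ∀ N {f g} → f ≗ g → ∑ N f ≡ ∑ N g
  ∑-cong zero    f≗g = refl
  ∑-cong (suc N) f≗g = cong₂ _+_ (∑-cong N f≗g) (f≗g N)

X : ℕ → Series
X k = U k ⊛ C

V : (ℕ → ℕ) → Series
V v n = ∑ n (λ k → v k * X k n)

β-V : ∀ n → β n ≡ V (const 1) n
β-V n = trans (length-sum (balancedPairs n)) (sum-balancedPairs (const 1) n)

ρ-V : ∀ n → ρ n ≡ V id n
ρ-V = sum-balancedPairs id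

-- Evaluating convolution operators at 1/3

Always Eventually : (ℕ → Set) → Set
Always P     = ∀ n → P n
Eventually P = ∃[ N ] (∀ n → N ≤ n → P n)

eventually-zip : ∀ {P Q R : ℕ → Set} → (∀ n → P n → Q n → R n) → Eventually P → Eventually Q → Eventually R
eventually-zip f (N , p) (N′ , q) =
  N ⊔ N′ , λ n N⊔N′≤n → f n (p n (m⊔n≤o⇒m≤o N N′ N⊔N′≤n)) (q n (m⊔n≤o⇒n≤o N N′ N⊔N′≤n))

eventually-map : ∀ {P Q : ℕ → Set} → (∀ n → P n → Q n) → Eventually P → Eventually Q
eventually-map f (N , p) = N , λ n N≤n → f n (p n N≤n)

always-zip : ∀ {P Q R : ℕ → Set} → (∀ n → P n → Q n → R n) → Always P → Always Q → Always R
always-zip f p q n = f n (p n) (q n)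

-- `Bounded f p q` says that f ⊛_ multiplies growth rates by a factor ≼ p/q.
module Operator
  (_≼_ : ℕ → ℕ → Set)
  (≼-trans : ∀ {a b c} → a ≼ b → b ≼ c → a ≼ c)
  (≼-+ : ∀ {a b c d} → a ≼ b → c ≼ d → (a + c) ≼ (b + d))
  (≼-* : ∀ k {a b} → a ≼ b → (k * a) ≼ (k * b))
  (≼-cancel : ∀ k .{{_ : NonZero k}} {a b} → (k * a) ≼ (k * b) → a ≼ b)
  (Ev : (ℕ → Set) → Set)
  (Ev-zip : ∀ {P Q R : ℕ → Set} → (∀ n → P n → Q n → R n) → Ev P → Ev Q → Ev R)
  (e : Series)
  where

  Ev-map : ∀ {P Q : ℕ → Set} → (∀ n → P n → Q n) → Ev P → Ev Q
  Ev-map f p = Ev-zip (λ n x _ → f n x) p p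

  -- Cross-multiplied form of `y n / e n ≼ a / d`. In `Low` the order is reversed, so rates become
  -- lower bounds.
  Rate : Series → ℕ → ℕ → Set
  Rate y a d = Ev (λ n → (d * y n) ≼ (a * e n))

  Bounded : Series → ℕ → ℕ → Set
  Bounded f p q = ∀ y a d → Rate y a d → Rate (f ⊛ y) (p * a) (q * d)

  bounded-cong : ∀ {f g} p q → f ≗ g → Bounded f p q → Bounded g p q
  bounded-cong p q f≗g bf y a d r =
    Ev-map (λ n → subst (λ x → (q * d * x) ≼ (p * a * e n)) (⊛-cong {g = y} f≗g (λ _ → refl) n)) (bf y a d r)

  bounded-weaken : ∀ {f} p q p′ q′ .{{_ : NonZero q}} → (p * q′) ≼ (p′ * q) → Bounded f p q → Bounded f p′ q′
  bounded-weaken {f} p q p′ q′ pq′≼p′q bf y a d r = Ev-map (λ n h → ≼-cancel q (≼-trans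
      (subst₂ _≼_ (l₁ q′ q d ((f ⊛ y) n)) (l₂ q′ p a (e n)) (≼-* q′ h))
      (subst (((a * e n) * (p * q′)) ≼_) (l₃ a (e n) p′ q) (≼-* (a * e n) pq′≼p′q))))
    (bf y a d r)
    where
    l₁ : ∀ q′ q d y → q′ * (q * d * y) ≡ q * (q′ * d * y)
    l₁ = solve-∀
    l₂ : ∀ q′ p a e → q′ * (p * a * e) ≡ (a * e) * (p * q′)
    l₂ = solve-∀
    l₃ : ∀ a e p′ q → (a * e) * (p′ * q) ≡ q * (p′ * a * e)
    l₃ = solve-∀

  -- The factor obtained is s/t · p/q · (1 + p′/q′). Since boundedness holds for every argument,
  -- products of series are handled by applying one factor after the other. Two bounds for the same
  -- `f` are allowed so that a sharp one can be combined with a crude one.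
  bounded-step : ∀ {f g} s t p q p′ q′ → g ≗ z ⊛ (f ⊕ f ⊛ f) →
    Bounded z s t → Bounded f p q → Bounded f p′ q′ → Bounded g (s * (p * (q′ + p′))) (t * (q * q′))
  bounded-step {f} {g} s t p q p′ q′ g-eq bz bf bf′ =
    bounded-cong (s * (p * (q′ + p′))) (t * (q * q′)) (λ n → sym (g-eq n)) λ y a d r →
    let zy = bz y a d r
    in Ev-zip (λ n h h′ → subst₂ _≼_
         (trans (l₁ q′ q t d ((f ⊛ (z ⊛ y)) n) ((f ⊛ (f ⊛ (z ⊛ y))) n))
                (cong (t * (q * q′) * d *_) (sym (expand y n))))
         (l₂ q′ p p′ s a (e n))
         (≼-+ (≼-* q′ h) h′))
       (bf (z ⊛ y) (s * a) (t * d) zy)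
       (bf (f ⊛ (z ⊛ y)) (p′ * (s * a)) (q′ * (t * d)) (bf′ (z ⊛ y) (s * a) (t * d) zy))
    where
    l₁ : ∀ q′ q t d x y → q′ * (q * (t * d) * x) + q * (q′ * (t * d)) * y ≡ t * (q * q′) * d * (x + y)
    l₁ = solve-∀
    l₂ : ∀ q′ p p′ s a e → q′ * (p * (s * a) * e) + p * (p′ * (s * a)) * e ≡ s * (p * (q′ + p′)) * a * e
    l₂ = solve-∀
    expand : ∀ y → (z ⊛ (f ⊕ f ⊛ f)) ⊛ y ≗ f ⊛ (z ⊛ y) ⊕ f ⊛ (f ⊛ (z ⊛ y))
    expand = solveSeries 3 (λ z f y → (z :* (f :+ f :* f)) :* y := f :* (z :* y) :+ f :* (f :* (z :* y)))
               (λ _ → refl) z f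

module Low = Operator _≥_ (λ p q → ≤-trans q p) +-mono-≤ (λ k → *-monoʳ-≤ k) (λ k → *-cancelˡ-≤ k)
  Eventually eventually-zip C

module Up = Operator _≤_ ≤-trans +-mono-≤ (λ k → *-monoʳ-≤ k) (λ k → *-cancelˡ-≤ k)
  Eventually eventually-zip C

-- C 1 = C 0, so that C itself does not double at every step.
doubling : Series
doubling zero    = 1
doubling (suc n) = 2 * C (suc n)

module Dom = Operator _≤_ ≤-trans +-mono-≤ (λ k → *-monoʳ-≤ k) (λ k → *-cancelˡ-≤ k)
  Always always-zip doubling

low-z : Low.Bounded z 1 3
low-z y a d (N , r) = suc N , λ { (suc n) (s≤s N≤n) → begin
    1 * a * C (suc n)         ≤⟨ *-monoʳ-≤ (1 * a) (ratio-≤3 n) ⟩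
    1 * a * (3 * C n)         ≡⟨ l a (C n) ⟩
    3 * (a * C n)             ≤⟨ *-monoʳ-≤ 3 (r n N≤n) ⟩
    3 * (d * y n)             ≡⟨ *-assoc 3 d (y n) ⟨
    3 * d * y n               ≡⟨ cong (3 * d *_) (z⊛-suc y n) ⟨
    3 * d * (z ⊛ y) (suc n)   ∎ }
  where
  open ≤-Reasoning
  l : ∀ a c → 1 * a * (3 * c) ≡ 3 * (a * c)
  l = solve-∀

-- The ratio of `C` is bounded by 3 from above, so lower bounds may use 1/3 exactly, but for upper
-- bounds `ratio→3` yields only factors strictly above 1/3, and only eventually.
up-z : ∀ s t → t < 3 * s → Up.Bounded z s t
up-z s t t<3s y a d (N , r) = suc (N ⊔ 2 * s) , λ { (suc n) (s≤s N≤n) → begin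
    t * d * (z ⊛ y) (suc n)   ≡⟨ cong (t * d *_) (z⊛-suc y n) ⟩
    t * d * y n               ≡⟨ *-assoc t d (y n) ⟩
    t * (d * y n)             ≤⟨ *-monoʳ-≤ t (r n (m⊔n≤o⇒m≤o N (2 * s) N≤n)) ⟩
    t * (a * C n)             ≡⟨ l t a (C n) ⟩
    a * (t * C n)             ≤⟨ *-monoʳ-≤ a (ratio→3 s t t<3s n (m⊔n≤o⇒n≤o N (2 * s) N≤n)) ⟩
    a * (s * C (suc n))       ≡⟨ l′ a s (C (suc n)) ⟩
    s * a * C (suc n)         ∎ }
  where
  open ≤-Reasoning
  l : ∀ t a c → t * (a * c) ≡ a * (t * c)
  l = solve-∀
  l′ : ∀ a s c → a * (s * c) ≡ s * a * c
  l′ = solve-∀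

dom-z : Dom.Bounded z 1 2
dom-z y a d r zero = ≤-trans (≤-reflexive (*-zeroʳ (2 * d))) z≤n
dom-z y a d r (suc n) = begin
    2 * d * (z ⊛ y) (suc n)   ≡⟨ cong (2 * d *_) (z⊛-suc y n) ⟩
    2 * d * y n               ≡⟨ *-assoc 2 d (y n) ⟩
    2 * (d * y n)             ≤⟨ *-monoʳ-≤ 2 (r n) ⟩
    2 * (a * doubling n)      ≡⟨ l a (doubling n) ⟩
    1 * a * (2 * doubling n)  ≤⟨ *-monoʳ-≤ (1 * a) (doubles n) ⟩
    1 * a * doubling (suc n)  ∎
  where
  open ≤-Reasoning
  l : ∀ a c → 2 * (a * c) ≡ 1 * a * (2 * c)
  l = solve-∀
  doubles : ∀ n → 2 * doubling n ≤ doubling (suc n)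
  doubles zero    = ≤-reflexive (cong (2 *_) (sym C₁≡1))
  doubles (suc n) = *-monoʳ-≤ 2 (ratio-≥2 n)

-- Against `doubling`, z counts as 1/2. As `U k` never counts for more than 1/2, each step
-- multiplies its factor by at most 1/2 · (1 + 1/2) = 3/4.
dom-U : ∀ k → Dom.Bounded (U k) (3 ^ k) (2 * 4 ^ k)
dom-U zero    = Dom.bounded-cong 1 2 (λ n → sym (U-zero n)) dom-z
dom-U (suc k) = subst₂ (Dom.Bounded (U (suc k))) (l (3 ^ k)) (l′ (4 ^ k))
  (Dom.bounded-step 1 2 (3 ^ k) (2 * 4 ^ k) 1 2 (U-suc k) dom-z (dom-U k) half)
  where
  instance
    4^k≢0 : NonZero (4 ^ k)
    4^k≢0 = m^n≢0 4 k
    2*4^k≢0 : NonZero (2 * 4 ^ k)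
    2*4^k≢0 = m*n≢0 2 (4 ^ k)
  l : ∀ x → 1 * (x * (2 + 1)) ≡ 3 * x
  l = solve-∀
  l′ : ∀ x → 2 * (2 * x * 2) ≡ 2 * (4 * x)
  l′ = solve-∀
  half : Dom.Bounded (U k) 1 2
  half = Dom.bounded-weaken (3 ^ k) (2 * 4 ^ k) 1 2 (begin
      3 ^ k * 2           ≡⟨ *-comm (3 ^ k) 2 ⟩
      2 * 3 ^ k           ≤⟨ *-monoʳ-≤ 2 (^-monoˡ-≤ k (n≤1+n 3)) ⟩
      2 * 4 ^ k           ≡⟨ *-identityˡ (2 * 4 ^ k) ⟨
      1 * (2 * 4 ^ k)     ∎)
    (dom-U k)
    where open ≤-Reasoning

-- The factor 2 lost in passing from `doubling` back to `C` is repaid by the initial 1/2 in `dom-U`.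
X-dom : ∀ k n → 4 ^ k * X k n ≤ 3 ^ k * C n
X-dom k n = *-cancelˡ-≤ 2 (begin
    2 * (4 ^ k * X k n)         ≡⟨ l (4 ^ k) (X k n) ⟩
    2 * 4 ^ k * 1 * X k n       ≤⟨ dom-U k C 1 1 C≤doubling n ⟩
    3 ^ k * 1 * doubling n      ≤⟨ *-monoʳ-≤ (3 ^ k * 1) (doubling≤2C n) ⟩
    3 ^ k * 1 * (2 * C n)       ≡⟨ l′ (3 ^ k) (C n) ⟩
    2 * (3 ^ k * C n)           ∎)
  where
  open ≤-Reasoning
  l : ∀ x y → 2 * (x * y) ≡ 2 * x * 1 * y
  l = solve-∀
  l′ : ∀ x y → x * 1 * (2 * y) ≡ 2 * (x * y)
  l′ = solve-∀
  C≤doubling : ∀ n → 1 * C n ≤ 1 * doubling n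
  C≤doubling zero    = ≤-refl
  C≤doubling (suc n) = *-monoʳ-≤ 1 (m≤m+n (C (suc n)) _)
  doubling≤2C : ∀ n → doubling n ≤ 2 * C n
  doubling≤2C zero    = s≤s z≤n
  doubling≤2C (suc n) = ≤-refl

-- Fixed-point enclosures of the growth constants

module Digits (D : ℕ) .{{_ : NonZero D}} where

  instance
    3D≢0 : NonZero (3 * D)
    3D≢0 = m*n≢0 3 D
    DD≢0 : NonZero (D * D)
    DD≢0 = m*n≢0 D D

  -- The map u ↦ (u + u²)/3 in units of 1/D, rounded down.
  image : ℕ → ℕ
  image x = x * (D + x) ℕ./ (3 * D)

  -- lo k / D and hi k / D enclose bₖ, where b₀ = 1/3 and bₖ₊₁ = (bₖ + bₖ²)/3.
  lo hi : ℕ → ℕ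
  lo zero    = D ℕ./ 3
  lo (suc k) = image (lo k)
  hi zero    = 1 + D ℕ./ 3
  hi (suc k) = 1 + image (hi k)

  -- Adding 1 even to an exact quotient keeps the inequality strict, as `up-z` requires.
  <-1+/ : ∀ m n .{{_ : NonZero n}} → m < (1 + m ℕ./ n) * n
  <-1+/ m n = subst (_< (1 + m ℕ./ n) * n) (sym (m≡m%n+[m/n]*n m n)) (+-monoˡ-< (m ℕ./ n * n) (m%n<n m n))

  low-U : ∀ k → Low.Bounded (U k) (lo k) D
  low-U zero = Low.bounded-cong (D ℕ./ 3) D (λ n → sym (U-zero n)) (Low.bounded-weaken 1 3 (D ℕ./ 3) D
    (≤-trans (m/n*n≤m D 3) (≤-reflexive (sym (*-identityˡ D)))) low-z)
  low-U (suc k) = Low.bounded-weaken (1 * (x * (D + x))) (3 * (D * D)) (image x) D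
      (begin
        image x * (3 * (D * D))     ≡⟨ l (image x) D ⟩
        image x * (3 * D) * D       ≤⟨ *-monoˡ-≤ D (m/n*n≤m (x * (D + x)) (3 * D)) ⟩
        x * (D + x) * D             ≡⟨ cong (_* D) (*-identityˡ (x * (D + x))) ⟨
        1 * (x * (D + x)) * D       ∎)
      (Low.bounded-step 1 3 x D x D (U-suc k) low-z (low-U k) (low-U k))
    where
    open ≤-Reasoning
    x = lo k
    instance
      3DD≢0 : NonZero (3 * (D * D))
      3DD≢0 = m*n≢0 3 (D * D)
    l : ∀ y d → y * (3 * (d * d)) ≡ y * (3 * d) * d
    l = solve-∀

  hi≢0 : ∀ k → NonZero (hi k)
  hi≢0 zero    = _
  hi≢0 (suc k) = _

  up-U : ∀ k → Up.Bounded (U k) (hi k) D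
  up-U zero = Up.bounded-cong (1 + D ℕ./ 3) D (λ n → sym (U-zero n))
    (up-z (1 + D ℕ./ 3) D (subst (D <_) (*-comm (1 + D ℕ./ 3) 3) (<-1+/ D 3)))
  up-U (suc k) = Up.bounded-weaken (s * H) (H * (D * D)) (hi (suc k)) D
      (≤-reflexive (l (hi (suc k)) D H))
      (Up.bounded-step s H x D x D (U-suc k) (up-z s H H<3s) (up-U k) (up-U k))
    where
    x = hi k
    H = x * (D + x)
    -- Giving z the factor s/H makes the product in `bounded-step` exactly `hi (suc k)` / D. The
    -- factor exceeds 1/3 because `hi (suc k)` is strictly above the unrounded image.
    s = hi (suc k) * D
    instance
      x≢0 : NonZero x
      x≢0 = hi≢0 k
      D+x≢0 : NonZero (D + x)
      D+x≢0 = >-nonZero (≤-trans (>-nonZero⁻¹ D) (m≤m+n D x))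
      H≢0 : NonZero H
      H≢0 = m*n≢0 x (D + x)
      HDD≢0 : NonZero (H * (D * D))
      HDD≢0 = m*n≢0 H (D * D)
    l : ∀ y d h → y * d * h * d ≡ y * (h * (d * d))
    l = solve-∀
    l′ : ∀ y d → y * (3 * d) ≡ 3 * (y * d)
    l′ = solve-∀
    H<3s : H < 3 * s
    H<3s = subst (H <_) (l′ (hi (suc k)) D) (<-1+/ H (3 * D))

  X-low : ∀ k → Eventually (λ n → lo k * C n ≤ D * X k n)
  X-low k = eventually-map (λ n → subst₂ (λ a d → a * C n ≤ d * X k n) (*-identityʳ (lo k)) (*-identityʳ D))
    (low-U k C 1 1 (0 , λ _ _ → ≤-refl))

  X-up : ∀ k → Eventually (λ n → D * X k n ≤ hi k * C n)
  X-up k = eventually-map (λ n → subst₂ (λ a d → d * X k n ≤ a * C n) (*-identityʳ (hi k)) (*-identityʳ D))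
    (up-U k C 1 1 (0 , λ _ _ → ≤-refl))

-- Tails

∑-mono : ∀ N {f g} → (∀ k → k < N → f k ≤ g k) → ∑ N f ≤ ∑ N g
∑-mono zero    f≤g = z≤n
∑-mono (suc N) f≤g = +-mono-≤ (∑-mono N (λ k k<N → f≤g k (m<n⇒m<1+n k<N))) (f≤g N ≤-refl)

∑-split : ∀ K d f → ∑ (K + d) f ≡ ∑ K f + ∑ d (λ k → f (K + k))
∑-split K zero    f rewrite +-identityʳ K = sym (+-identityʳ (∑ K f))
∑-split K (suc d) f rewrite +-suc K d | ∑-split K d f = +-assoc (∑ K f) _ _

∑-extend : ∀ {K N} f → K ≤ N → ∑ K f ≤ ∑ N f
∑-extend {K} {N} f K≤N = begin
  ∑ K f                                    ≤⟨ m≤m+n (∑ K f) _ ⟩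
  ∑ K f + ∑ (N ∸ K) (λ k → f (K + k))      ≡⟨ ∑-split K (N ∸ K) f ⟨
  ∑ (K + (N ∸ K)) f                        ≡⟨ cong (λ m → ∑ m f) (m+[n∸m]≡n K≤N) ⟩
  ∑ N f                                    ∎
  where open ≤-Reasoning

∑-scale : ∀ N c f → ∑ N (λ k → c * f k) ≡ c * ∑ N f
∑-scale zero    c f = sym (*-zeroʳ c)
∑-scale (suc N) c f rewrite ∑-scale N c f = sym (*-distribˡ-+ c (∑ N f) (f N))

∑-eventually : ∀ K (v : ℕ → ℕ) {f g : ℕ → Series} → (∀ k → Eventually (λ n → f k n ≤ g k n)) →
  Eventually (λ n → ∑ K (λ k → v k * f k n) ≤ ∑ K (λ k → v k * g k n))
∑-eventually zero    v f≤g = 0 , λ _ _ → z≤n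
∑-eventually (suc K) v f≤g =
  eventually-zip (λ _ p q → +-mono-≤ p (*-monoʳ-≤ (v K) q)) (∑-eventually K v f≤g) (f≤g K)

∑-factorˡ : ∀ N c (v f : ℕ → ℕ) → ∑ N (λ k → v k * (c * f k)) ≡ c * ∑ N (λ k → v k * f k)
∑-factorˡ zero    c v f = sym (*-zeroʳ c)
∑-factorˡ (suc N) c v f rewrite ∑-factorˡ N c v f = l c (∑ N (λ k → v k * f k)) (v N) (f N)
  where
  l : ∀ c s v f → c * s + v * (c * f) ≡ c * (s + v * f)
  l = solve-∀

∑-factorʳ : ∀ N c (v f : ℕ → ℕ) → ∑ N (λ k → v k * (f k * c)) ≡ ∑ N (λ k → v k * f k) * c
∑-factorʳ zero    c v f = refl
∑-factorʳ (suc N) c v f rewrite ∑-factorʳ N c v f = l c (∑ N (λ k → v k * f k)) (v N) (f N)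
  where
  l : ∀ c s v f → s * c + v * (f * c) ≡ (s + v * f) * c
  l = solve-∀

geometric-sum : ∀ e h → (∀ k → h k * 8 ^ k ≤ e * 7 ^ k) → ∀ d → ∑ d h ≤ 8 * e
geometric-sum e h h≤ d = *-cancelʳ-≤ (∑ d h) (8 * e) (8 ^ d) {{m^n≢0 8 d}} (m+n≤o⇒m≤o _ (partial d))
  where
  open ≤-Reasoning
  -- The added term is the sum of the geometric majorant from d on; with it the induction closes.
  partial : ∀ d → ∑ d h * 8 ^ d + 8 * e * 7 ^ d ≤ 8 * e * 8 ^ d
  partial zero    = ≤-refl
  partial (suc d) = begin
    (∑ d h + h d) * (8 * 8 ^ d) + 8 * e * (7 * 7 ^ d)               ≡⟨ l (∑ d h) (h d) (8 ^ d) e (7 ^ d) ⟩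
    8 * (h d * 8 ^ d) + (8 * (∑ d h * 8 ^ d) + 8 * e * (7 * 7 ^ d)) ≤⟨ +-monoˡ-≤ _ (*-monoʳ-≤ 8 (h≤ d)) ⟩
    8 * (e * 7 ^ d) + (8 * (∑ d h * 8 ^ d) + 8 * e * (7 * 7 ^ d))   ≡⟨ l′ (∑ d h * 8 ^ d) e (7 ^ d) ⟩
    8 * (∑ d h * 8 ^ d + 8 * e * 7 ^ d)                             ≤⟨ *-monoʳ-≤ 8 (partial d) ⟩
    8 * (8 * e * 8 ^ d)                                             ≡⟨ l″ e (8 ^ d) ⟩
    8 * e * (8 * 8 ^ d)                                             ∎
    where
    l : ∀ s h x e y → (s + h) * (8 * x) + 8 * e * (7 * y) ≡ 8 * (h * x) + (8 * (s * x) + 8 * e * (7 * y))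
    l = solve-∀
    l′ : ∀ s e y → 8 * (e * y) + (8 * s + 8 * e * (7 * y)) ≡ 8 * (s + 8 * e * y)
    l′ = solve-∀
    l″ : ∀ e x → 8 * (8 * e * x) ≡ 8 * e * (8 * x)
    l″ = solve-∀

^-distribʳ-* : ∀ k m n → (m * n) ^ k ≡ m ^ k * n ^ k
^-distribʳ-* zero    m n = refl
^-distribʳ-* (suc k) m n rewrite ^-distribʳ-* k m n = l m n (m ^ k) (n ^ k)
  where
  l : ∀ m n x y → m * n * (x * y) ≡ m * x * (n * y)
  l = solve-∀

-- A weak form of Bernoulli's inequality for 1 + 1/a. With a = 6 it controls the weight k, with a =
-- 7 it makes (7/8)ᴷ small.
n*a^n≤a*[1+a]^n : ∀ a n → n * a ^ n ≤ a * (1 + a) ^ n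
n*a^n≤a*[1+a]^n a zero    = z≤n
n*a^n≤a*[1+a]^n a (suc n) = begin
  suc n * (a * a ^ n)                         ≡⟨ l n a (a ^ n) ⟩
  a * (n * a ^ n) + a * a ^ n                 ≤⟨ +-mono-≤ (*-monoʳ-≤ a (n*a^n≤a*[1+a]^n a n))
                                                          (*-monoʳ-≤ a (^-monoˡ-≤ n (n≤1+n a))) ⟩
  a * (a * (1 + a) ^ n) + a * (1 + a) ^ n     ≡⟨ l′ a ((1 + a) ^ n) ⟩
  a * ((1 + a) * (1 + a) ^ n)                 ∎
  where
  open ≤-Reasoning
  l : ∀ n a x → suc n * (a * x) ≡ a * (n * x) + a * x
  l = solve-∀
  l′ : ∀ a y → a * (a * y) + a * y ≡ a * ((1 + a) * y)
  l′ = solve-∀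

-- Growth at rate 7/6 is enough for both weights, and against the domination by (3/4)ᵏ it leaves the
-- ratio 3/4 · 7/6 = 7/8 < 1.
Tame : (ℕ → ℕ) → Set
Tame v = ∀ k → v k * 6 ^ k ≤ 6 * 7 ^ k

tame-1 : Tame (const 1)
tame-1 k = *-mono-≤ {1} {6} {6 ^ k} {7 ^ k} (s≤s z≤n) (^-monoˡ-≤ k (n≤1+n 6))

tame-id : Tame id
tame-id = n*a^n≤a*[1+a]^n 6

tame-dom : ∀ v → Tame v → ∀ k n → v k * X k n * 8 ^ k ≤ 6 * C n * 7 ^ k
tame-dom v tame k n = begin
  v k * X k n * (2 * 4) ^ k         ≡⟨ cong (v k * X k n *_) (^-distribʳ-* k 2 4) ⟩
  v k * X k n * (2 ^ k * 4 ^ k)     ≡⟨ l (v k) (X k n) (2 ^ k) (4 ^ k) ⟩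
  v k * 2 ^ k * (4 ^ k * X k n)     ≤⟨ *-monoʳ-≤ (v k * 2 ^ k) (X-dom k n) ⟩
  v k * 2 ^ k * (3 ^ k * C n)       ≡⟨ l′ (v k) (2 ^ k) (3 ^ k) (C n) ⟩
  v k * (2 ^ k * 3 ^ k) * C n       ≡⟨ cong (λ x → v k * x * C n) (^-distribʳ-* k 2 3) ⟨
  v k * 6 ^ k * C n                 ≤⟨ *-monoˡ-≤ (C n) (tame k) ⟩
  6 * 7 ^ k * C n                   ≡⟨ l″ (7 ^ k) (C n) ⟩
  6 * C n * 7 ^ k                   ∎
  where
  open ≤-Reasoning
  l : ∀ v x a b → v * x * (a * b) ≡ v * a * (b * x)
  l = solve-∀
  l′ : ∀ v a b c → v * a * (b * c) ≡ v * (a * b) * c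
  l′ = solve-∀
  l″ : ∀ y c → 6 * y * c ≡ 6 * c * y
  l″ = solve-∀

-- Here 48 = 8 · 6, where 8 = 1 / (1 - 7/8) and 6 is the constant of `Tame`. The bound is uniform in
-- n, which justifies exchanging the limit with the sum over ranks.
V-tail : ∀ v → Tame v → ∀ K n → K ≤ n →
  8 ^ K * V v n ≤ 8 ^ K * ∑ K (λ k → v k * X k n) + 48 * 7 ^ K * C n
V-tail v tame K n K≤n = begin
  8 ^ K * ∑ n f                                                   ≡⟨ cong (λ m → 8 ^ K * ∑ m f) (m+[n∸m]≡n K≤n) ⟨
  8 ^ K * ∑ (K + (n ∸ K)) f                                       ≡⟨ cong (8 ^ K *_) (∑-split K (n ∸ K) f) ⟩
  8 ^ K * (∑ K f + ∑ (n ∸ K) (λ k → f (K + k)))                   ≡⟨ *-distribˡ-+ (8 ^ K) (∑ K f) _ ⟩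
  8 ^ K * ∑ K f + 8 ^ K * ∑ (n ∸ K) (λ k → f (K + k))             ≡⟨ cong (8 ^ K * ∑ K f +_)
                                                                       (∑-scale (n ∸ K) (8 ^ K) (λ k → f (K + k))) ⟨
  8 ^ K * ∑ K f + ∑ (n ∸ K) (λ k → 8 ^ K * f (K + k))             ≤⟨ +-monoʳ-≤ (8 ^ K * ∑ K f)
                                                                       (geometric-sum (6 * C n * 7 ^ K) _ dominated (n ∸ K)) ⟩
  8 ^ K * ∑ K f + 8 * (6 * C n * 7 ^ K)                           ≡⟨ cong (8 ^ K * ∑ K f +_) (l (C n) (7 ^ K)) ⟩
  8 ^ K * ∑ K f + 48 * 7 ^ K * C n                                ∎
  where
  open ≤-Reasoning
  f : ℕ → ℕ
  f k = v k * X k n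
  l : ∀ c y → 8 * (6 * c * y) ≡ 48 * y * c
  l = solve-∀
  l′ : ∀ a x b → a * x * b ≡ x * (a * b)
  l′ = solve-∀
  dominated : ∀ k → 8 ^ K * f (K + k) * 8 ^ k ≤ 6 * C n * 7 ^ K * 7 ^ k
  dominated k = begin
    8 ^ K * f (K + k) * 8 ^ k         ≡⟨ l′ (8 ^ K) (f (K + k)) (8 ^ k) ⟩
    f (K + k) * (8 ^ K * 8 ^ k)       ≡⟨ cong (f (K + k) *_) (^-distribˡ-+-* 8 K k) ⟨
    f (K + k) * 8 ^ (K + k)           ≤⟨ tame-dom v tame (K + k) n ⟩
    6 * C n * 7 ^ (K + k)             ≡⟨ cong (6 * C n *_) (^-distribˡ-+-* 7 K k) ⟩
    6 * C n * (7 ^ K * 7 ^ k)         ≡⟨ *-assoc (6 * C n) (7 ^ K) (7 ^ k) ⟨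
    6 * C n * 7 ^ K * 7 ^ k           ∎

-- Enclosures of the weighted sums and their width

module Enclosure (D : ℕ) .{{_ : NonZero D}} where

  open Digits D

  V-low : ∀ v K → Eventually (λ n → ∑ K (λ k → v k * lo k) * C n ≤ D * V v n)
  V-low v K with N , low ← ∑-eventually K v X-low = N ⊔ K , λ n N⊔K≤n → begin
      ∑ K (λ k → v k * lo k) * C n           ≡⟨ ∑-factorʳ K (C n) v lo ⟨
      ∑ K (λ k → v k * (lo k * C n))         ≤⟨ low n (m⊔n≤o⇒m≤o N K N⊔K≤n) ⟩
      ∑ K (λ k → v k * (D * X k n))          ≡⟨ ∑-factorˡ K D v (λ k → X k n) ⟩
      D * ∑ K (λ k → v k * X k n)            ≤⟨ *-monoʳ-≤ D (∑-extend (λ k → v k * X k n) (m⊔n≤o⇒n≤o N K N⊔K≤n)) ⟩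
      D * V v n                              ∎
    where open ≤-Reasoning

  -- A lower bound may drop the terms from K on; here they cost `t`, measured like `hi` in units of
  -- 1/D.
  V-up : ∀ v → Tame v → ∀ K t → D * (48 * 7 ^ K) ≤ t * 8 ^ K →
    Eventually (λ n → D * V v n ≤ (∑ K (λ k → v k * hi k) + t) * C n)
  V-up v tame K t tail≤t with N , up ← ∑-eventually K v X-up = N ⊔ K , λ n N⊔K≤n →
    let S = ∑ K (λ k → v k * X k n)
        H = ∑ K (λ k → v k * hi k)
    in *-cancelˡ-≤ (8 ^ K) {{m^n≢0 8 K}} (begin
      8 ^ K * (D * V v n)                        ≡⟨ l (8 ^ K) D (V v n) ⟩
      D * (8 ^ K * V v n)                        ≤⟨ *-monoʳ-≤ D (V-tail v tame K n (m⊔n≤o⇒n≤o N K N⊔K≤n)) ⟩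
      D * (8 ^ K * S + 48 * 7 ^ K * C n)         ≡⟨ l′ D (8 ^ K) S (48 * 7 ^ K) (C n) ⟩
      8 ^ K * (D * S) + D * (48 * 7 ^ K) * C n   ≤⟨ +-mono-≤ (*-monoʳ-≤ (8 ^ K) (begin
        D * S                                      ≡⟨ ∑-factorˡ K D v (λ k → X k n) ⟨
        ∑ K (λ k → v k * (D * X k n))              ≤⟨ up n (m⊔n≤o⇒m≤o N K N⊔K≤n) ⟩
        ∑ K (λ k → v k * (hi k * C n))             ≡⟨ ∑-factorʳ K (C n) v hi ⟩
        H * C n                                    ∎))
                                                    (*-monoˡ-≤ (C n) tail≤t) ⟩
      8 ^ K * (H * C n) + t * 8 ^ K * C n        ≡⟨ l″ (8 ^ K) H (C n) t ⟩
      8 ^ K * ((H + t) * C n)                    ∎)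
    where
    open ≤-Reasoning
    l : ∀ e d v → e * (d * v) ≡ d * (e * v)
    l = solve-∀
    l′ : ∀ d e s y c → d * (e * s + y * c) ≡ e * (d * s) + d * y * c
    l′ = solve-∀
    l″ : ∀ e h c t → e * (h * c) + t * e * c ≡ e * ((h + t) * c)
    l″ = solve-∀

  image<D : ∀ x → x ≤ D → image x < D
  image<D x x≤D = m<n*o⇒m/o<n {n = D} {o = 3 * D} (begin-strict
    x * (D + x)       ≤⟨ *-mono-≤ x≤D (+-monoʳ-≤ D x≤D) ⟩
    D * (D + D)       <⟨ *-monoʳ-< D (+-monoʳ-< D (m<m+n D (≤-trans (>-nonZero⁻¹ D) (m≤m+n D 0)))) ⟩
    D * (3 * D)       ∎)
    where open ≤-Reasoning

  lo≤D : ∀ k → lo k ≤ D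
  lo≤D zero    = <⇒≤ (m/n<m D 3 (s≤s (s≤s z≤n)))
  lo≤D (suc k) = <⇒≤ (image<D (lo k) (lo≤D k))

  hi≤D : ∀ k → hi k ≤ D
  hi≤D zero    = m/n<m D 3 (s≤s (s≤s z≤n))
  hi≤D (suc k) = image<D (hi k) (hi≤D k)

  -- On [0, 1] the derivative (1 + 2u)/3 of u ↦ (u + u²)/3 is at most 1, so an error is not
  -- amplified.
  image-lipschitz : ∀ x y g → x ≤ D → y ≤ D → y ≤ x + g → image y ≤ image x + g
  image-lipschitz x y g x≤D y≤D y≤x+g = s≤s⁻¹ (m<n*o⇒m/o<n {n = 1 + image x + g} {o = 3 * D} (begin-strict
    y * (D + y)                                    ≡⟨ *-distribˡ-+ y D y ⟩
    y * D + y * y                                  ≤⟨ +-mono-≤ (*-monoˡ-≤ D y≤x+g) (begin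
      y * y                                          ≤⟨ *-monoˡ-≤ y y≤x+g ⟩
      (x + g) * y                                    ≡⟨ *-distribʳ-+ y x g ⟩
      x * y + g * y                                  ≤⟨ +-mono-≤ (*-monoʳ-≤ x y≤x+g) (*-monoʳ-≤ g y≤D) ⟩
      x * (x + g) + g * D                            ≡⟨ l x g D ⟩
      x * x + g * D + x * g                          ≤⟨ +-monoʳ-≤ (x * x + g * D) (*-monoˡ-≤ g x≤D) ⟩
      x * x + g * D + D * g                          ∎) ⟩
    (x + g) * D + (x * x + g * D + D * g)          ≡⟨ l′ x g D ⟩
    x * (D + x) + g * (3 * D)                      <⟨ +-monoˡ-< (g * (3 * D)) (<-1+/ (x * (D + x)) (3 * D)) ⟩
    (1 + image x) * (3 * D) + g * (3 * D)          ≡⟨ *-distribʳ-+ (3 * D) (1 + image x) g ⟨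
    (1 + image x + g) * (3 * D)                    ∎))
    where
    open ≤-Reasoning
    l : ∀ x g d → x * (x + g) + g * d ≡ x * x + g * d + x * g
    l = solve-∀
    l′ : ∀ x g d → (x + g) * d + (x * x + g * d + d * g) ≡ x * (d + x) + g * (3 * d)
    l′ = solve-∀

  -- Only the rounding adds to the gap, one unit per step.
  hi≤lo+ : ∀ k → hi k ≤ lo k + (1 + k)
  hi≤lo+ zero    = ≤-reflexive (+-comm 1 (D ℕ./ 3))
  hi≤lo+ (suc k) = ≤-trans (s≤s (image-lipschitz (lo k) (hi k) (1 + k) (lo≤D k) (hi≤D k) (hi≤lo+ k)))
    (≤-reflexive (sym (+-suc (lo (suc k)) (1 + k))))

  gap : ∀ (v : ℕ → ℕ) K → (∀ k → k < K → v k ≤ K) →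
    ∑ K (λ k → v k * hi k) ≤ ∑ K (λ k → v k * lo k) + K * (K * K)
  gap v K v≤K = partial K ≤-refl
    where
    open ≤-Reasoning
    l : ∀ a b c n → a + b + (c + n) ≡ a + c + (n + b)
    l = solve-∀
    partial : ∀ J → J ≤ K → ∑ J (λ k → v k * hi k) ≤ ∑ J (λ k → v k * lo k) + J * (K * K)
    partial zero    _   = z≤n
    partial (suc J) J<K = begin
      ∑ J (λ k → v k * hi k) + v J * hi J
        ≤⟨ +-mono-≤ (partial J (<⇒≤ J<K)) (begin
          v J * hi J                        ≤⟨ *-monoʳ-≤ (v J) (hi≤lo+ J) ⟩
          v J * (lo J + (1 + J))            ≡⟨ *-distribˡ-+ (v J) (lo J) (1 + J) ⟩
          v J * lo J + v J * (1 + J)        ≤⟨ +-monoʳ-≤ (v J * lo J) (*-mono-≤ (v≤K J J<K) J<K) ⟩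
          v J * lo J + K * K                ∎) ⟩
      ∑ J (λ k → v k * lo k) + J * (K * K) + (v J * lo J + K * K)
        ≡⟨ l (∑ J (λ k → v k * lo k)) (J * (K * K)) (v J * lo J) (K * K) ⟩
      ∑ J (λ k → v k * lo k) + v J * lo J + (K * K + J * (K * K)) ∎

-- The ratio ρ / β

-- Leaves alone suffice: all are balanced, and trees with n + 1 vertices and a marked leaf number
-- `C n`.
C≤3β : ∀ n → C (suc n) ≤ 3 * β (suc n)
C≤3β n = ≤-trans (ratio-≤3 n) (*-monoʳ-≤ 3 (begin
  C n                                  ≡⟨ z⊛-suc C n ⟨
  (z ⊛ C) (suc n)                      ≡⟨ ⊛-cong {g = C} U-zero (λ _ → refl) (suc n) ⟨
  X 0 (suc n)                          ≡⟨ *-identityˡ (X 0 (suc n)) ⟨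
  ∑ 1 (λ k → 1 * X k (suc n))          ≤⟨ ∑-extend {1} {suc n} (λ k → 1 * X k (suc n)) (s≤s z≤n) ⟩
  V (const 1) (suc n)                  ≡⟨ β-V (suc n) ⟨
  β (suc n)                            ∎))
  where open ≤-Reasoning

ρ≤48C : ∀ n → ρ n ≤ 48 * C n
ρ≤48C n = begin
  ρ n                  ≡⟨ ρ-V n ⟩
  V id n               ≡⟨ *-identityˡ (V id n) ⟨
  1 * V id n           ≤⟨ V-tail id tame-id 0 n z≤n ⟩
  48 * C n             ∎
  where open ≤-Reasoning

-- ρ, β, c and ρ′, β′, c′ stand for the values of ρ, β and C at two indices.
cross-bound : ∀ D .{{_ : NonZero D}} R S E {ρ β c ρ′ β′ c′} →
  D * ρ ≤ (R + E) * c → S * c ≤ D * β → R * c′ ≤ D * ρ′ → D * β′ ≤ (S + E) * c′ →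
  c ≤ 3 * β → ρ′ ≤ 48 * c′ → c′ ≤ 3 * β′ →
  D * (ρ * β′) ≤ D * (ρ′ * β) + 435 * E * (β * β′)
cross-bound D R S E {ρ} {β} {c} {ρ′} {β′} {c′} ρ-up β-low ρ′-low β′-up c≤3β ρ′≤48c′ c′≤3β′ =
  *-cancelˡ-≤ D (begin
    D * (D * (ρ * β′))                                      ≡⟨ l₁ D ρ β′ ⟩
    D * ρ * (D * β′)                                        ≤⟨ *-monoˡ-≤ (D * β′) ρ-up ⟩
    (R + E) * c * (D * β′)                                  ≡⟨ l₂ R E c (D * β′) ⟩
    R * c * (D * β′) + E * c * (D * β′)                     ≤⟨ +-monoˡ-≤ _ (*-monoʳ-≤ (R * c) β′-up) ⟩
    R * c * ((S + E) * c′) + E * c * (D * β′)               ≡⟨ l₃ R c S E c′ (D * β′) ⟩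
    -- Exchanging `c` and `c′` pairs `R` and `S` with the indices at which their lower bounds are
    -- given.
    R * c′ * (S * c) + E * c * (R * c′ + D * β′)            ≤⟨ +-mono-≤ (*-mono-≤ ρ′-low β-low)
                                                                 (*-monoʳ-≤ (E * c) (+-monoˡ-≤ (D * β′) ρ′-low)) ⟩
    D * ρ′ * (D * β) + E * c * (D * ρ′ + D * β′)            ≤⟨ +-monoʳ-≤ (D * ρ′ * (D * β)) (*-mono-≤
                                                                 (*-monoʳ-≤ E c≤3β)
                                                                 (+-monoˡ-≤ (D * β′) (*-monoʳ-≤ D
                                                                   (≤-trans ρ′≤48c′ (*-monoʳ-≤ 48 c′≤3β′))))) ⟩
    D * ρ′ * (D * β) + E * (3 * β) * (D * (48 * (3 * β′)) + D * β′) ≡⟨ l₄ D ρ′ β E β′ ⟩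
    D * (D * (ρ′ * β) + 435 * E * (β * β′))                 ∎)
  where
  open ≤-Reasoning
  l₁ : ∀ d r b → d * (d * (r * b)) ≡ d * r * (d * b)
  l₁ = solve-∀
  l₂ : ∀ r e c b → (r + e) * c * b ≡ r * c * b + e * c * b
  l₂ = solve-∀
  l₃ : ∀ r c s e c′ b → r * c * ((s + e) * c′) + e * c * b ≡ r * c′ * (s * c) + e * c * (r * c′ + b)
  l₃ = solve-∀
  l₄ : ∀ d r b e b′ → d * r * (d * b) + e * (3 * b) * (d * (48 * (3 * b′)) + d * b′)
                      ≡ d * (d * (r * b) + 435 * e * (b * b′))
  l₄ = solve-∀

-- Cross-multiplied form of a one-sided distance of at most 1/m between two ratios; as i and j may
-- be exchanged, one side is enough.
ratio-cauchy : ∀ m .{{_ : NonZero m}} → ∃[ N ] (∀ i j → N ≤ i → N ≤ j →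
  m * (ρ (suc i) * β (suc j)) ≤ m * (ρ (suc j) * β (suc i)) + β (suc i) * β (suc j))
ratio-cauchy m = N , λ i j N≤i N≤j →
  let ρ-low′ , ρ-up′ = proj₂ ρ-enclosed (suc i) (≤-trans (m≤m⊔n Nρ Nβ) (≤-trans N≤i (n≤1+n i)))
      β-low′ , β-up′ = proj₂ β-enclosed (suc i) (≤-trans (m≤n⊔m Nρ Nβ) (≤-trans N≤i (n≤1+n i)))
      ρ-low″ , ρ-up″ = proj₂ ρ-enclosed (suc j) (≤-trans (m≤m⊔n Nρ Nβ) (≤-trans N≤j (n≤1+n j)))
      β-low″ , β-up″ = proj₂ β-enclosed (suc j) (≤-trans (m≤n⊔m Nρ Nβ) (≤-trans N≤j (n≤1+n j)))
      b = β (suc i)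
      b′ = β (suc j)
  in *-cancelˡ-≤ (870 * G) (begin
    870 * G * (m * (ρ (suc i) * b′))                              ≡⟨ l₁ m G (ρ (suc i) * b′) ⟩
    D * (ρ (suc i) * b′)                                          ≤⟨ cross-bound D R S (G + G) ρ-up′ β-low′ ρ-low″ β-up″
                                                                       (C≤3β i) (ρ≤48C (suc j)) (C≤3β j) ⟩
    D * (ρ (suc j) * b) + 435 * (G + G) * (b * b′)                ≡⟨ l₂ m G (ρ (suc j) * b) (b * b′) ⟩
    870 * G * (m * (ρ (suc j) * b) + b * b′)                      ∎)
  where
  open ≤-Reasoning
  -- 870 = 2 · 435 and 435 = 3 · (48 · 3 + 1).  Both the tails beyond K and the rounding errors are at most G.
  K = 7 * (870 * m * 48)
  G = K * (K * K)
  D = 870 * m * G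
  instance
    870m≢0 : NonZero (870 * m)
    870m≢0 = m*n≢0 870 m
    870m48≢0 : NonZero (870 * m * 48)
    870m48≢0 = m*n≢0 (870 * m) 48
    K≢0 : NonZero K
    K≢0 = m*n≢0 7 (870 * m * 48)
    K²≢0 : NonZero (K * K)
    K²≢0 = m*n≢0 K K
    G≢0 : NonZero G
    G≢0 = m*n≢0 K (K * K)
    D≢0 : NonZero D
    D≢0 = m*n≢0 (870 * m) G
    870G≢0 : NonZero (870 * G)
    870G≢0 = m*n≢0 870 G
  open Digits D using (lo; hi)
  open Enclosure D

  l₁ : ∀ m g x → 870 * g * (m * x) ≡ 870 * m * g * x
  l₁ = solve-∀
  l₂ : ∀ m g x y → 870 * m * g * x + 435 * (g + g) * y ≡ 870 * g * (m * x + y)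
  l₂ = solve-∀

  -- Since (7/8)ᴷ ≤ 7/K, the choice of `K` gives 48 · (7/8)ᴷ ≤ 1/(870m), which is G/D.
  tail≤G : D * (48 * 7 ^ K) ≤ G * 8 ^ K
  tail≤G = begin
    D * (48 * 7 ^ K)                 ≡⟨ l (870 * m) G (7 ^ K) ⟩
    G * (870 * m * 48 * 7 ^ K)       ≤⟨ *-monoʳ-≤ G (*-cancelˡ-≤ 7 (begin
      7 * (870 * m * 48 * 7 ^ K)       ≡⟨ *-assoc 7 (870 * m * 48) (7 ^ K) ⟨
      K * 7 ^ K                        ≤⟨ n*a^n≤a*[1+a]^n 7 K ⟩
      7 * 8 ^ K                        ∎)) ⟩
    G * 8 ^ K                        ∎
    where
    l : ∀ m g y → m * g * (48 * y) ≡ g * (m * 48 * y)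
    l = solve-∀

  enclosed : ∀ v → Tame v → (∀ k → k < K → v k ≤ K) → Eventually (λ n →
    ∑ K (λ k → v k * lo k) * C n ≤ D * V v n × D * V v n ≤ (∑ K (λ k → v k * lo k) + (G + G)) * C n)
  enclosed v tame v≤K = eventually-zip (λ n low up → low , (begin
      D * V v n                                              ≤⟨ up ⟩
      (∑ K (λ k → v k * hi k) + G) * C n                     ≤⟨ *-monoˡ-≤ (C n) (+-monoˡ-≤ G (gap v K v≤K)) ⟩
      (∑ K (λ k → v k * lo k) + G + G) * C n                 ≡⟨ cong (_* C n) (+-assoc (∑ K (λ k → v k * lo k)) G G) ⟩
      (∑ K (λ k → v k * lo k) + (G + G)) * C n               ∎))
    (V-low v K) (V-up v tame K G tail≤G)

  R = ∑ K (λ k → k * lo k)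
  S = ∑ K (λ k → 1 * lo k)

  ρ-enclosed : Eventually (λ n → R * C n ≤ D * ρ n × D * ρ n ≤ (R + (G + G)) * C n)
  ρ-enclosed = eventually-map (λ n → subst (λ x → R * C n ≤ D * x × D * x ≤ (R + (G + G)) * C n) (sym (ρ-V n)))
    (enclosed id tame-id (λ k → <⇒≤))

  β-enclosed : Eventually (λ n → S * C n ≤ D * β n × D * β n ≤ (S + (G + G)) * C n)
  β-enclosed = eventually-map (λ n → subst (λ x → S * C n ≤ D * x × D * x ≤ (S + (G + G)) * C n) (sym (β-V n)))
    (enclosed (const 1) tame-1 (λ _ k<K → ≤-trans (s≤s z≤n) k<K))

  Nρ = proj₁ ρ-enclosed
  Nβ = proj₁ β-enclosed
  N = Nρ ⊔ Nβ

-- The numerical conditions are boolean comparisons, so that for concrete numbers they are settled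
-- by evaluation.
module Numerics (D K t : ℕ) .{{_ : NonZero D}} (tail≤t : T (D * (48 * 7 ^ K) ≤ᵇ t * 8 ^ K)) where

  open Digits D
  open Enclosure D

  private
    V-ratio : ∀ v w → Tame w → ∀ p q → T (p * (∑ K (λ k → w k * hi k) + t) ≤ᵇ q * ∑ K (λ k → v k * lo k)) →
      Eventually (λ n → p * V w n ≤ q * V v n)
    V-ratio v w tame p q check = eventually-zip (λ n low up → *-cancelˡ-≤ D (begin
        D * (p * V w n)                                    ≡⟨ l D p (V w n) ⟩
        p * (D * V w n)                                    ≤⟨ *-monoʳ-≤ p up ⟩
        p * ((∑ K (λ k → w k * hi k) + t) * C n)           ≡⟨ *-assoc p _ (C n) ⟨
        p * (∑ K (λ k → w k * hi k) + t) * C n             ≤⟨ *-monoˡ-≤ (C n) check′ ⟩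
        q * ∑ K (λ k → v k * lo k) * C n                   ≡⟨ *-assoc q _ (C n) ⟩
        q * (∑ K (λ k → v k * lo k) * C n)                 ≤⟨ *-monoʳ-≤ q low ⟩
        q * (D * V v n)                                    ≡⟨ l D q (V v n) ⟨
        D * (q * V v n)                                    ∎))
      (V-low v K) (V-up w tame K t (≤ᵇ⇒≤ (D * (48 * 7 ^ K)) (t * 8 ^ K) tail≤t))
      where
      open ≤-Reasoning
      check′ : p * (∑ K (λ k → w k * hi k) + t) ≤ q * ∑ K (λ k → v k * lo k)
      check′ = ≤ᵇ⇒≤ _ _ check
      l : ∀ d p v → d * (p * v) ≡ p * (d * v)
      l = solve-∀

  ratio-≥ : ∀ p q → T (p * (∑ K (λ k → 1 * hi k) + t) ≤ᵇ q * ∑ K (λ k → k * lo k)) →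
    Eventually (λ n → p * β n ≤ q * ρ n)
  ratio-≥ p q check = eventually-map (λ n → subst₂ (λ x y → p * x ≤ q * y) (sym (β-V n)) (sym (ρ-V n)))
    (V-ratio id (const 1) tame-1 p q check)

  ratio-≤ : ∀ p q → T (q * (∑ K (λ k → k * hi k) + t) ≤ᵇ p * ∑ K (λ k → 1 * lo k)) →
    Eventually (λ n → q * ρ n ≤ p * β n)
  ratio-≤ p q check = eventually-map (λ n → subst₂ (λ x y → q * x ≤ p * y) (sym (ρ-V n)) (sym (β-V n)))
    (V-ratio (const 1) id tame-id q p check)

-- Limits of rational sequences

open ℤ using (+_)
open import Defs using (β-nonZero)

/-mono : ∀ {p q p′ q′} .{{_ : NonZero q}} .{{_ : NonZero q′}} → p * q′ ≤ p′ * q → (+ p / q) ℚᵘ.≤ (+ p′ / q′)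
/-mono {p} {suc q} {p′} {suc q′} pq′≤p′q =
  *≤* (subst₂ ℤ._≤_ (ℤₚ.pos-* p (suc q′)) (ℤₚ.pos-* p′ (suc q)) (ℤ.+≤+ pq′≤p′q))

-- A positive ε is at least the reciprocal of its denominator, so that reciprocal serves as the
-- precision.
/-≤-+ : ∀ {p q p′ q′} .{{_ : NonZero q}} .{{_ : NonZero q′}} ε → 0ℚᵘ ℚᵘ.< ε →
  ↧ₙ ε * (p * q′) ≤ ↧ₙ ε * (p′ * q) + q * q′ → (+ p / q) ℚᵘ.≤ (+ p′ / q′) ℚᵘ.+ ε
/-≤-+ (mkℚᵘ (+ zero) _) (*<* (ℤ.+<+ ())) _
/-≤-+ {p} {suc q} {p′} {suc q′} (mkℚᵘ (+ suc e) d) _ h = ℚᵘₚ.≤-trans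
  (/-mono {p} {suc q} {p′ * suc d + suc e * suc q′} {suc q′ * suc d} (begin
    p * (suc q′ * suc d)                           ≡⟨ l₁ p (suc q′) (suc d) ⟩
    suc d * (p * suc q′)                           ≤⟨ h ⟩
    suc d * (p′ * suc q) + suc q * suc q′          ≤⟨ +-monoʳ-≤ (suc d * (p′ * suc q)) (m≤m+n _ (e * (suc q * suc q′))) ⟩
    suc d * (p′ * suc q) + suc e * (suc q * suc q′) ≡⟨ l₂ (suc d) p′ (suc q) (suc e) (suc q′) ⟩
    (p′ * suc d + suc e * suc q′) * suc q          ∎))
  (ℚᵘₚ.≤-reflexive-≡ (cong (_/ (suc q′ * suc d))
    (trans (ℤₚ.pos-+ (p′ * suc d) (suc e * suc q′))
           (cong₂ ℤ._+_ (ℤₚ.pos-* p′ (suc d)) (ℤₚ.pos-* (suc e) (suc q′))))))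
  where
  open ≤-Reasoning
  l₁ : ∀ p b d → p * (b * d) ≡ d * (p * b)
  l₁ = solve-∀
  l₂ : ∀ d p b e b′ → d * (p * b) + e * (b * b′) ≡ (p * d + e * b′) * b
  l₂ = solve-∀

≤+⇒-≤ : ∀ p q r → p ℚᵘ.≤ q ℚᵘ.+ r → p ℚᵘ.- r ℚᵘ.≤ q
≤+⇒-≤ p q r p≤q+r = ℚᵘₚ.≤-trans (ℚᵘₚ.+-monoˡ-≤ (ℚᵘ.- r) p≤q+r) (ℚᵘₚ.≤-reflexive
  (ℚᵘₚ.≃-trans (ℚᵘₚ.+-assoc q r (ℚᵘ.- r))
    (ℚᵘₚ.≃-trans (ℚᵘₚ.+-congʳ q (ℚᵘₚ.+-inverseʳ r)) (ℚᵘₚ.+-identityʳ q))))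

≤+⇒∣-∣≤ : ∀ p q r → p ℚᵘ.≤ q ℚᵘ.+ r → q ℚᵘ.≤ p ℚᵘ.+ r → ℚᵘ.∣ p ℚᵘ.- q ∣ ℚᵘ.≤ r
≤+⇒∣-∣≤ p q r p≤q+r q≤p+r with ℚᵘₚ.∣p∣≡p∨∣p∣≡-p (p ℚᵘ.- q)
... | inj₁ eq = subst (ℚᵘ._≤ r) (sym eq)
  (≤+⇒-≤ p r q (ℚᵘₚ.≤-trans p≤q+r (ℚᵘₚ.≤-reflexive (ℚᵘₚ.+-comm q r))))
... | inj₂ eq = subst (ℚᵘ._≤ r) (sym eq) (ℚᵘₚ.≤-trans
  (ℚᵘₚ.≤-reflexive (ℚᵘₚ.≃-trans (ℚᵘₚ.≃-reflexive (ℚᵘₚ.neg-distrib-+ p (ℚᵘ.- q)))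
    (ℚᵘₚ.≃-trans (ℚᵘₚ.+-congʳ (ℚᵘ.- p) (ℚᵘₚ.neg-involutive q)) (ℚᵘₚ.+-comm (ℚᵘ.- p) q))))
  (≤+⇒-≤ q r p (ℚᵘₚ.≤-trans q≤p+r (ℚᵘₚ.≤-reflexive (ℚᵘₚ.+-comm p r)))))

≤⇒≤+ : ∀ p q ε → 0ℚᵘ ℚᵘ.< ε → p ℚᵘ.≤ q → p ℚᵘ.≤ q ℚᵘ.+ ε
≤⇒≤+ p q ε 0<ε p≤q = ℚᵘₚ.≤-trans p≤q (ℚᵘₚ.≤-trans
  (ℚᵘₚ.≤-reflexive (ℚᵘₚ.≃-sym (ℚᵘₚ.+-identityʳ q))) (ℚᵘₚ.+-monoʳ-≤ q (ℚᵘₚ.<⇒≤ 0<ε)))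

-- The sequence represents its own limit. One-sided closeness suffices because the two indices may
-- be exchanged.
module Limit (a : ℕ → ℚᵘ)
  (a-cauchy : ∀ ε → 0ℚᵘ ℚᵘ.< ε → ∃[ N ] (∀ m n → N ≤ m → N ≤ n → a m ℚᵘ.≤ a n ℚᵘ.+ ε)) where

  limit : ℝ
  limit = record
    { approx = a
    ; cauchy = λ ε 0<ε → let N , close = a-cauchy ε 0<ε in
        N , λ m n N≤m N≤n → ≤+⇒∣-∣≤ (a m) (a n) ε (close m n N≤m N≤n) (close n m N≤n N≤m)
    }

  converges : a ConvergesTo limit
  converges ε 0<ε = let N , close = a-cauchy ε 0<ε in N , λ n N≤n →
      (λ δ 0<δ → N , λ m N≤m →
        ≤⇒≤+ (a n ℚᵘ.- ε) (a m) δ 0<δ (≤+⇒-≤ (a n) (a m) ε (close n m N≤n N≤m)))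
    , (λ δ 0<δ → N , λ m N≤m → ≤⇒≤+ (a m) (a n ℚᵘ.+ ε) δ 0<δ (close m n N≤m N≤n))

  fromℚ≤limit : ∀ q N → (∀ n → N ≤ n → q ℚᵘ.≤ a n) → fromℚ q ≤ᴿ limit
  fromℚ≤limit q N q≤a ε 0<ε = N , λ n N≤n → ≤⇒≤+ q (a n) ε 0<ε (q≤a n N≤n)

  limit≤fromℚ : ∀ q N → (∀ n → N ≤ n → a n ℚᵘ.≤ q) → limit ≤ᴿ fromℚ q
  limit≤fromℚ q N a≤q ε 0<ε = N , λ n N≤n → ≤⇒≤+ (a n) q ε 0<ε (a≤q n N≤n)

ranks : ℕ → ℚᵘ
ranks n = expectedRank (suc n)

ranks-cauchy : ∀ ε → 0ℚᵘ ℚᵘ.< ε → ∃[ N ] (∀ m n → N ≤ m → N ≤ n → ranks m ℚᵘ.≤ ranks n ℚᵘ.+ ε)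
ranks-cauchy ε 0<ε = let N , close = ratio-cauchy (↧ₙ ε) in
  N , λ m n N≤m N≤n → /-≤-+ {ρ (suc m)} {β (suc m)} {ρ (suc n)} {β (suc n)} ε 0<ε (close m n N≤m N≤n)

open Limit ranks ranks-cauchy

-- The third argument is an upper bound of 48 · (7/8)⁴⁰⁰ · 10⁴⁰.
module Digits₁₇ = Numerics 10000000000000000000000000000000000000000 400 3051142183675783000 tt

below-limit : ∀ p q .{{_ : NonZero q}} → Eventually (λ n → p * β n ≤ q * ρ n) → fromℚ (+ p / q) ≤ᴿ limit
below-limit p q (N , le) = fromℚ≤limit (+ p / q) N λ n N≤n → /-mono {p} {q} {ρ (suc n)} {β (suc n)}
  (≤-trans (le (suc n) (≤-trans N≤n (n≤1+n n))) (≤-reflexive (*-comm q (ρ (suc n)))))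

above-limit : ∀ p q .{{_ : NonZero q}} → Eventually (λ n → q * ρ n ≤ p * β n) → limit ≤ᴿ fromℚ (+ p / q)
above-limit p q (N , le) = limit≤fromℚ (+ p / q) N λ n N≤n → /-mono {ρ (suc n)} {β (suc n)} {p} {q}
  (≤-trans (≤-reflexive (*-comm (ρ (suc n)) q)) (le (suc n) (≤-trans N≤n (n≤1+n n))))

theorem4p8 : Σ[ L ∈ ℝ ]
    ((λ n → expectedRank (suc n)) ConvergesTo L
    × fromℚ (+ 6464847301966947 / 10000000000000000) ≤ᴿ L
    × L ≤ᴿ fromℚ (+ 64648473019669473 / 100000000000000000))
theorem4p8 = limit , converges
  , below-limit 6464847301966947 10000000000000000 (Digits₁₇.ratio-≥ 6464847301966947 10000000000000000 tt)
  , above-limit 64648473019669473 100000000000000000 (Digits₁₇.ratio-≤ 64648473019669473 100000000000000000 tt)
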